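{- There is a function $f$ such that, for any integer $k>2$, every $2$-connected graph with order at least $f(k)$ contains a parallel minor isomorphic to $K_{2,k}'$, $C_k$, $F_k$, or $K_k$.
   Context: All graphs are finite and simple; the order of a graph is its number of vertices. A graph $M$ is a parallel minor of a graph $G$ if $M$ is (isomorphic to) the simple graph obtained from $G$ by contracting some set of edges and then deleting all loops and all but one edge from each class of parallel edges. $C_k$ is the cycle on $k$ vertices and $K_k$ the complete graph on $k$ vertices. $K_{2,k}'$ is the graph obtained from the complete bipartite graph $K_{2,k}$ by adding the edge joining its two vertices of degree $k$. The fan $F_k$ is obtained from a path on $k$ vertices by adding one new vertex adjacent to every vertex of the path. -}

module Defs where

open import Data.Nat using (ℕ; zero; suc; _<_; _≤_; _≡ᵇ_; _<ᵇ_)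
open import Data.Fin using (Fin; toℕ)
open import Data.Bool using (Bool; true; false; _∧_; _∨_; not)
open import Data.Product using (Σ; _×_; _,_; ∃)
open import Data.Sum using (_⊎_)
open import Relation.Binary.PropositionalEquality using (_≡_; _≢_)
open import Relation.Nullary using (¬_)

record Graph : Set where
  field
    order : ℕ
    adj   : Fin order → Fin order → Bool
open Graph public

Edge : (G : Graph) → Fin (order G) → Fin (order G) → Set
Edge G x y = adj G x y ≡ true

Simple : Graph → Set
Simple G = (∀ x y → adj G x y ≡ adj G y x) × (∀ x → adj G x x ≡ false)

data Reach {n : ℕ} (R : Fin n → Fin n → Set) : Fin n → Fin n → Set where
  here : ∀ {x} → Reach R x x
  step : ∀ {x y z} → R x y → Reach R y z → Reach R x z

Connected : Graph → Set
Connected G = ∀ x y → Reach (Edge G) x y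

ConnectedWithout : (G : Graph) → Fin (order G) → Set
ConnectedWithout G v =
  ∀ x y → x ≢ v → y ≢ v →
    Reach (λ a b → Edge G a b × a ≢ v × b ≢ v) x y

TwoConnected : Graph → Set
TwoConnected G = 2 < order G × Connected G × (∀ v → ConnectedWithout G v)

-- H is a parallel minor of G: there is a set S of edges of G such that
-- contracting S (identifying the vertices joined by S-walks) and then
-- deleting loops and parallel edges yields H.  The map φ sends each vertex
-- of G to the vertex of H into which it is contracted.
record ParallelMinor (H G : Graph) : Set where
  field
    S        : Fin (order G) → Fin (order G) → Bool
    S⊆E      : ∀ x y → S x y ≡ true → Edge G x y
    φ        : Fin (order G) → Fin (order H)
    φ-onto   : ∀ a → ∃ λ x → φ x ≡ a
    φ-classes : ∀ x y →
      (φ x ≡ φ y → Reach (λ a b → S a b ≡ true ⊎ S b a ≡ true) x y) ×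
      (Reach (λ a b → S a b ≡ true ⊎ S b a ≡ true) x y → φ x ≡ φ y)
    φ-edges  : ∀ a b →
      (Edge H a b → a ≢ b × ∃ λ x → ∃ λ y → φ x ≡ a × φ y ≡ b × Edge G x y) ×
      (a ≢ b × (∃ λ x → ∃ λ y → φ x ≡ a × φ y ≡ b × Edge G x y) → Edge H a b)

_==_ : {n : ℕ} → Fin n → Fin n → Bool
i == j = toℕ i ≡ᵇ toℕ j

Kₖ : ℕ → Graph
Kₖ k = record { order = k ; adj = λ i j → not (i == j) }

Cₖ : ℕ → Graph
Cₖ k = record { order = k ; adj = λ i j →
  (suc (toℕ i) ≡ᵇ toℕ j) ∨ (suc (toℕ j) ≡ᵇ toℕ i) ∨
  ((toℕ i ≡ᵇ 0) ∧ (suc (toℕ j) ≡ᵇ k)) ∨ ((toℕ j ≡ᵇ 0) ∧ (suc (toℕ i) ≡ᵇ k)) }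

-- K'_{2,k}: vertices 0,1 are the two degree-k vertices of K_{2,k}, joined
-- by an extra edge; vertices 2..k+1 form the other side.
K2k′ : ℕ → Graph
K2k′ k = record { order = suc (suc k) ; adj = λ i j →
  not (i == j) ∧ ((toℕ i <ᵇ 2) ∨ (toℕ j <ᵇ 2)) }

-- fan F_k: vertex 0 is the apex, vertices 1..k form a path
Fₖ : ℕ → Graph
Fₖ k = record { order = suc k ; adj = λ i j →
  not (i == j) ∧ ((toℕ i ≡ᵇ 0) ∨ (toℕ j ≡ᵇ 0) ∨
                  (suc (toℕ i) ≡ᵇ toℕ j) ∨ (suc (toℕ j) ≡ᵇ toℕ i)) }

{-# OPTIONS --safe #-}
-- Split G along a path of connected bags: if the last bag C contains v adjacent
-- to the previous bag, either C - v has k components, and these, v and V \ C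
-- give K'_{2,k}, or a large component of C - v becomes the new last bag.  So we
-- may contract G to a long Hamiltonian path in which, by 2-connectivity, every
-- inner vertex is jumped over by an edge.
--
-- In an interval J of such a path, look for an edge with an end strictly inside
-- J that spans a large part of J, and pass to that part.  If this succeeds
-- often, many vertices on one side reach across J, and contracting the other
-- side gives a long path together with an apex adjacent to all of it.
-- Otherwise some interval meets only short edges and can be cut into pieces
-- adjacent only to the next ones: this yields C_k if an edge spans the
-- interval, and F_k if there already is an apex.  Repeating the argument on
-- the path below the apexes yields F_k or K_k.
--
-- To begin, if the path has no long edge, the greedy chain of edges jumping
-- over each other contracts it to the square of a path; contracting all odd
-- vertices to one then gives an apex over the path of the even vertices.
module Submission where

open import Defs
open import Data.Bool using (Bool; true; false; _∧_; _∨_; not; if_then_else_)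
open import Data.Bool.Properties using (T-≡)
import Data.Bool.Properties as Bool
open import Data.Empty using (⊥-elim)
open import Data.Fin using (Fin; zero; suc; toℕ; fromℕ<)
open import Data.Fin.Properties using (toℕ<n; toℕ-fromℕ<; toℕ-injective; any?)
import Data.Fin.Properties as Fin
open import Data.Nat
open import Data.Nat.DivMod
open import Data.Nat.Properties
open import Data.Product using (Σ; ∃; ∃₂; _×_; _,_; proj₁; proj₂)
open import Data.Sum using (_⊎_; inj₁; inj₂; [_,_]′)
open import Function using (_∘_; Equivalence)
open import Relation.Binary.Construct.Closure.ReflexiveTransitive
  using (Star; ε; _◅_; _◅◅_; reverse)
import Relation.Binary.Construct.Closure.ReflexiveTransitive as Star
open import Relation.Binary.Definitions using (tri<; tri≈; tri>)
open import Relation.Binary.PropositionalEquality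
open import Relation.Nullary using (¬_; Dec; yes; no)
open import Relation.Nullary.Decidable using (_×-dec_)

-- Walks and Boolean tests.

fromReach : ∀ {n} {R : Fin n → Fin n → Set} {x y} → Reach R x y → Star R x y
fromReach here = ε
fromReach (step r p) = r ◅ fromReach p

toReach : ∀ {n} {R : Fin n → Fin n → Set} {x y} → Star R x y → Reach R x y
toReach ε = here
toReach (r ◅ p) = step r (toReach p)

-- Follow the walk to its first step out of `P`. This turns connectivity into an edge across a cut.
exit : {A : Set} {R : A → A → Set} (P : A → Bool) {x y : A} → Star R x y →
  P x ≡ true → P y ≡ false → ∃₂ λ a b → R a b × P a ≡ true × P b ≡ false
exit P ε px py with () ← trans (sym px) py
exit P (_◅_ {j = z} r rs) px py with P z in eq
... | true  = exit P rs eq py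
... | false = _ , _ , r , px , eq

∧-true⁻ : ∀ {a b} → a ∧ b ≡ true → a ≡ true × b ≡ true
∧-true⁻ {true} {true} refl = refl , refl

≡ᵇ-true⁻ : ∀ {m n} → (m ≡ᵇ n) ≡ true → m ≡ n
≡ᵇ-true⁻ {m} {n} e = ≡ᵇ⇒≡ m n (Equivalence.from T-≡ e)

≡ᵇ-true⁺ : ∀ {m n} → m ≡ n → (m ≡ᵇ n) ≡ true
≡ᵇ-true⁺ {m} {n} e = Equivalence.to T-≡ (≡⇒≡ᵇ m n e)

≡ᵇ-false⁺ : ∀ {m n} → m ≢ n → (m ≡ᵇ n) ≡ false
≡ᵇ-false⁺ {m} {n} m≢n with m ≡ᵇ n in eq
... | true  = ⊥-elim (m≢n (≡ᵇ-true⁻ eq))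
... | false = refl

≡ᵇ-false⁻ : ∀ {m n} → (m ≡ᵇ n) ≡ false → m ≢ n
≡ᵇ-false⁻ {m} {n} e m≡n with () ← trans (sym e) (≡ᵇ-true⁺ m≡n)

-- Contractions as labellings of the vertices.

module Contractions (G : Graph) (symm : ∀ x y → adj G x y ≡ adj G y x) where

  V : Set
  V = Fin (order G)

  Edge-sym : ∀ {x y} → Edge G x y → Edge G y x
  Edge-sym {x} {y} e = trans (symm y x) e

  -- A labelling c : V → ℕ stands for the contraction whose bags are its
  -- fibres; E c is the adjacency of the contracted graph.
  E : (V → ℕ) → ℕ → ℕ → Set
  E c p q = ∃₂ λ x y → c x ≡ p × c y ≡ q × Edge G x y

  E-sym : ∀ {c p q} → E c p q → E c q p
  E-sym (x , y , cx , cy , e) = y , x , cy , cx , Edge-sym e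

  E? : ∀ c p q → Dec (E c p q)
  E? c p q = any? λ x → any? λ y →
    (c x ≟ p) ×-dec (c y ≟ q) ×-dec (adj G x y Bool.≟ true)

  Within : (V → ℕ) → V → V → Set
  Within c a b = Edge G a b × c a ≡ c b

  Within-sym : ∀ {c a b} → Within c a b → Within c b a
  Within-sym (e , eq) = Edge-sym e , sym eq

  record Bags (m : ℕ) (c : V → ℕ) : Set where
    field
      bound : ∀ x → c x < m
      onto  : ∀ {p} → p < m → ∃ λ x → c x ≡ p
      conn  : ∀ {x y} → c x ≡ c y → Star (Within c) x y

    E-bound : ∀ {p q} → E c p q → p < m × q < m
    E-bound (x , y , refl , refl , _) = bound x , bound y
  open Bags public

  -- An edge between bags of `c` that the further contraction `g` merges.
  Link : (V → ℕ) → (ℕ → ℕ) → ℕ → ℕ → Set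
  Link c g p q = E c p q × g p ≡ g q

  Link-sym : ∀ {c g p q} → Link c g p q → Link c g q p
  Link-sym (e , eq) = E-sym e , sym eq

  E-map : ∀ {c p q} (g : ℕ → ℕ) → E c p q → E (g ∘ c) (g p) (g q)
  E-map g (x , y , refl , refl , e) = x , y , refl , refl , e

  E-unmap : ∀ {c p q} (g : ℕ → ℕ) → E (g ∘ c) p q →
    ∃₂ λ p′ q′ → g p′ ≡ p × g q′ ≡ q × E c p′ q′
  E-unmap {c} g (x , y , ex , ey , e) = c x , c y , ex , ey , x , y , refl , refl , e

  -- Each link is witnessed by an edge of `G`; the ends of consecutive witnesses share a bag and are
  -- joined inside it by `conn`.
  lift-path : ∀ {m c g} → Bags m c → ∀ {p q} → Star (Link c g) p q →
    ∀ {x y} → c x ≡ p → c y ≡ q → Star (Within (g ∘ c)) x y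
  lift-path {g = g} B ε cx cy =
    Star.map (λ (e , eq) → e , cong g eq) (conn B (trans cx (sym cy)))
  lift-path {g = g} B (((x′ , y′ , cx′ , cy′ , e) , eq) ◅ ps) cx cy =
    lift-path {g = g} B ε cx cx′ ◅◅
    ((e , trans (cong g cx′) (trans eq (cong g (sym cy′)))) ◅ lift-path B ps cy′ cy)

  -- Composition of contractions. Walks between bags lift to `G`, so connectivity of the merged bags
  -- can be checked on labels alone.
  relabel : ∀ {m m′ c} (g : ℕ → ℕ) → Bags m c →
    (∀ {p} → p < m → g p < m′) →
    (∀ {q} → q < m′ → ∃ λ p → p < m × g p ≡ q) →
    (∀ {p q} → p < m → q < m → g p ≡ g q → Star (Link c g) p q) →
    Bags m′ (g ∘ c)
  relabel {c = c} g B bd on cn = record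
    { bound = λ x → bd (bound B x)
    ; onto  = λ q< → let p , p< , gp = on q< ; x , cx = onto B p<
                     in x , trans (cong g cx) gp
    ; conn  = λ {x} {y} eq → lift-path B (cn (bound B x) (bound B y) eq) refl refl
    }

  -- Contract exactly the edges inside bags: `conn` puts each bag into one `S`-class, and no
  -- `S`-edge leaves a bag.
  toMinor : ∀ (H : Graph) {c} → Bags (order H) c →
    (∀ {a b} → Edge H a b → a ≢ b × E c (toℕ a) (toℕ b)) →
    (∀ {a b} → a ≢ b → E c (toℕ a) (toℕ b) → Edge H a b) →
    ParallelMinor H G
  toMinor H {c} B to from = record
    { S = S
    ; S⊆E = λ x y s → proj₁ (∧-true⁻ s)
    ; φ = φ
    ; φ-onto = λ a → let x , cx = onto B (toℕ<n a)
                     in x , toℕ-injective (trans (toℕφ x) cx)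
    ; φ-classes = λ x y →
        (λ eq → toReach (Star.map joined
                  (conn B (trans (sym (toℕφ x)) (trans (cong toℕ eq) (toℕφ y)))))) ,
        (λ r → classes (fromReach r))
    ; φ-edges = λ a b →
        (λ e → let a≢b , x , y , cx , cy , xy = to e
               in a≢b , x , y , toℕ-injective (trans (toℕφ x) cx)
                            , toℕ-injective (trans (toℕφ y) cy) , xy) ,
        (λ { (a≢b , x , y , refl , refl , e) →
               from a≢b (x , y , sym (toℕφ x) , sym (toℕφ y) , e) })
    }
    where
    S : V → V → Bool
    S x y = adj G x y ∧ (c x ≡ᵇ c y)

    φ : V → Fin (order H)
    φ x = fromℕ< (bound B x)

    toℕφ : ∀ x → toℕ (φ x) ≡ c x
    toℕφ x = toℕ-fromℕ< (bound B x)

    joined : ∀ {x y} → Within c x y → S x y ≡ true ⊎ S y x ≡ true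
    joined (e , eq) = inj₁ (cong₂ _∧_ e (≡ᵇ-true⁺ eq))

    same : ∀ {x y} → S x y ≡ true → φ x ≡ φ y
    same {x} {y} s = toℕ-injective
      (trans (toℕφ x) (trans (≡ᵇ-true⁻ (proj₂ (∧-true⁻ {adj G x y} s))) (sym (toℕφ y))))

    classes : ∀ {x y} → Star (λ a b → S a b ≡ true ⊎ S b a ≡ true) x y → φ x ≡ φ y
    classes ε = refl
    classes (inj₁ s ◅ p) = trans (same s) (classes p)
    classes (inj₂ s ◅ p) = trans (sym (same s)) (classes p)

-- Criteria for the four target minors.

∨-true⁻ : ∀ {a b} → a ∨ b ≡ true → a ≡ true ⊎ b ≡ true
∨-true⁻ {true}  _ = inj₁ refl
∨-true⁻ {false} e = inj₂ e

∨-true⁺ˡ : ∀ {a b} → a ≡ true → a ∨ b ≡ true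
∨-true⁺ˡ refl = refl

∨-true⁺ʳ : ∀ {a b} → b ≡ true → a ∨ b ≡ true
∨-true⁺ʳ {true}  _ = refl
∨-true⁺ʳ {false} e = e

not-true⁻ : ∀ {a} → not a ≡ true → a ≡ false
not-true⁻ {false} _ = refl

not-==⁻ : ∀ {n} {a b : Fin n} → not (a == b) ≡ true → a ≢ b
not-==⁻ e a≡b = ≡ᵇ-false⁻ (not-true⁻ e) (cong toℕ a≡b)

not-==⁺ : ∀ {n} {a b : Fin n} → a ≢ b → not (a == b) ≡ true
not-==⁺ a≢b = cong not (≡ᵇ-false⁺ (a≢b ∘ toℕ-injective))

<ᵇ-true⁻ : ∀ {m n} → (m <ᵇ n) ≡ true → m < n
<ᵇ-true⁻ {m} {n} e = <ᵇ⇒< m n (Equivalence.from T-≡ e)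

<ᵇ-true⁺ : ∀ {m n} → m < n → (m <ᵇ n) ≡ true
<ᵇ-true⁺ m<n = Equivalence.to T-≡ (<⇒<ᵇ m<n)

module Targets (G : Graph) (symm : ∀ x y → adj G x y ≡ adj G y x) where
  open Contractions G symm

  complete-minor : ∀ {k c} → Bags k c →
    (∀ {p q} → p < k → q < p → E c p q) → ParallelMinor (Kₖ k) G
  complete-minor {k} {c} B adjacent = toMinor (Kₖ k) B to (λ a≢b _ → not-==⁺ a≢b)
    where
    to : ∀ {a b} → Edge (Kₖ k) a b → a ≢ b × E c (toℕ a) (toℕ b)
    to {a} {b} e with not-==⁻ {a = a} {b} e | <-cmp (toℕ a) (toℕ b)
    ... | a≢b | tri< a<b _ _ = a≢b , E-sym (adjacent (toℕ<n b) a<b)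
    ... | a≢b | tri≈ _ a≡b _ = ⊥-elim (a≢b (toℕ-injective a≡b))
    ... | a≢b | tri> _ _ b<a = a≢b , adjacent (toℕ<n a) b<a

  -- Bag 0 is the apex. The last condition bounds only one end, but `E` is symmetric, so using it in
  -- both directions excludes every chord of the rim.
  fan-minor : ∀ {k c} → Bags (suc k) c →
    (∀ {i} → i < k → E c 0 (suc i)) →
    (∀ {i} → suc i < k → E c (suc i) (suc (suc i))) →
    (∀ {i j} → E c (suc i) (suc j) → j ≤ suc i) →
    ParallelMinor (Fₖ k) G
  fan-minor {k} {c} B spoke rim short = toMinor (Fₖ k) B to from
    where
    near : ∀ {p q} → p ≢ q → p < suc k → q < suc k →
      (p ≡ 0 ⊎ q ≡ 0 ⊎ suc p ≡ q ⊎ suc q ≡ p) → E c p q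
    near {q = zero} p≢q p< q< (inj₁ refl) = ⊥-elim (p≢q refl)
    near {q = suc q} p≢q p< (s≤s q<) (inj₁ refl) = spoke q<
    near {zero} p≢q p< q< (inj₂ (inj₁ refl)) = ⊥-elim (p≢q refl)
    near {suc p} p≢q (s≤s p<) q< (inj₂ (inj₁ refl)) = E-sym (spoke p<)
    near {zero} p≢q p< (s≤s q<) (inj₂ (inj₂ (inj₁ refl))) = spoke q<
    near {suc p} p≢q p< (s≤s q<) (inj₂ (inj₂ (inj₁ refl))) = rim q<
    near {q = zero} p≢q (s≤s p<) q< (inj₂ (inj₂ (inj₂ refl))) = E-sym (spoke p<)
    near {q = suc q} p≢q (s≤s p<) q< (inj₂ (inj₂ (inj₂ refl))) = E-sym (rim p<)

    to : ∀ {a b} → Edge (Fₖ k) a b → a ≢ b × E c (toℕ a) (toℕ b)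
    to {a} {b} e with ∧-true⁻ {not (a == b)} e
    ... | e₁ , e₂ = a≢b , near (a≢b ∘ toℕ-injective) (toℕ<n a) (toℕ<n b) cases
      where
      a≢b : a ≢ b
      a≢b = not-==⁻ {a = a} {b} e₁
      cases : toℕ a ≡ 0 ⊎ toℕ b ≡ 0 ⊎ suc (toℕ a) ≡ toℕ b ⊎ suc (toℕ b) ≡ toℕ a
      cases with ∨-true⁻ {toℕ a ≡ᵇ 0} e₂
      ... | inj₁ x = inj₁ (≡ᵇ-true⁻ x)
      ... | inj₂ e₃ with ∨-true⁻ {toℕ b ≡ᵇ 0} e₃
      ...   | inj₁ x = inj₂ (inj₁ (≡ᵇ-true⁻ x))
      ...   | inj₂ e₄ with ∨-true⁻ {suc (toℕ a) ≡ᵇ toℕ b} e₄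
      ...     | inj₁ x = inj₂ (inj₂ (inj₁ (≡ᵇ-true⁻ x)))
      ...     | inj₂ x = inj₂ (inj₂ (inj₂ (≡ᵇ-true⁻ {suc (toℕ b)} x)))

    from′ : ∀ p q → p ≢ q → E c p q →
      ((p ≡ᵇ 0) ∨ (q ≡ᵇ 0) ∨ (suc p ≡ᵇ q) ∨ (suc q ≡ᵇ p)) ≡ true
    from′ zero    q       _   _ = refl
    from′ (suc p) zero    _   _ = refl
    from′ (suc p) (suc q) p≢q e with <-cmp p q
    ... | tri< p<q _ _ = ∨-true⁺ˡ (≡ᵇ-true⁺ (≤-antisym p<q (short e)))
    ... | tri≈ _ p≡q _ = ⊥-elim (p≢q (cong suc p≡q))
    ... | tri> _ _ q<p = ∨-true⁺ʳ {suc p ≡ᵇ q} (≡ᵇ-true⁺ (≤-antisym q<p (short (E-sym e))))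

    from : ∀ {a b} → a ≢ b → E c (toℕ a) (toℕ b) → Edge (Fₖ k) a b
    from {a} {b} a≢b e = cong₂ _∧_ (not-==⁺ a≢b)
      (from′ (toℕ a) (toℕ b) (a≢b ∘ toℕ-injective) e)

  -- Chords are excluded separately: those among positive labels as for the fan, those at label 0 by
  -- the last condition.
  cycle-minor : ∀ {κ c} → 0 < κ → Bags (suc κ) c →
    (∀ {p} → p < κ → E c p (suc p)) → E c κ 0 →
    (∀ {i j} → E c (suc i) (suc j) → j ≤ suc i) →
    (∀ {i} → E c 0 (suc i) → i ≡ 0 ⊎ suc i ≡ κ) →
    ParallelMinor (Cₖ (suc κ)) G
  cycle-minor {κ} {c} 0<κ B rim close short ends =
    toMinor (Cₖ (suc κ)) B to (λ a≢b → from _ _ (a≢b ∘ toℕ-injective))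
    where
    near : ∀ {p q} → p < suc κ → q < suc κ →
      (suc p ≡ q ⊎ suc q ≡ p ⊎ (p ≡ 0 × q ≡ κ) ⊎ (q ≡ 0 × p ≡ κ)) → p ≢ q × E c p q
    near p< (s≤s q<) (inj₁ refl) = (λ e → 1+n≢n (sym e)) , rim q<
    near (s≤s p<) q< (inj₂ (inj₁ refl)) = 1+n≢n , E-sym (rim p<)
    near p< q< (inj₂ (inj₂ (inj₁ (refl , refl)))) = <⇒≢ 0<κ , E-sym close
    near p< q< (inj₂ (inj₂ (inj₂ (refl , refl)))) = (λ e → <⇒≢ 0<κ (sym e)) , close

    to : ∀ {a b} → Edge (Cₖ (suc κ)) a b → a ≢ b × E c (toℕ a) (toℕ b)
    to {a} {b} e = let p≢q , Epq = near (toℕ<n a) (toℕ<n b) cases in p≢q ∘ cong toℕ , Epq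
      where
      p = toℕ a
      q = toℕ b
      both : ∀ {x y z w} → ((x ≡ᵇ y) ∧ (z ≡ᵇ w)) ≡ true → x ≡ y × z ≡ w
      both {x} {y} e = let e₁ , e₂ = ∧-true⁻ {x ≡ᵇ y} e in ≡ᵇ-true⁻ e₁ , ≡ᵇ-true⁻ e₂
      cases : suc p ≡ q ⊎ suc q ≡ p ⊎ (p ≡ 0 × q ≡ κ) ⊎ (q ≡ 0 × p ≡ κ)
      cases with ∨-true⁻ {suc p ≡ᵇ q} e
      ... | inj₁ x = inj₁ (≡ᵇ-true⁻ x)
      ... | inj₂ e₃ with ∨-true⁻ {suc q ≡ᵇ p} e₃
      ...   | inj₁ x = inj₂ (inj₁ (≡ᵇ-true⁻ x))
      ...   | inj₂ e₄ with ∨-true⁻ {(p ≡ᵇ 0) ∧ (q ≡ᵇ κ)} e₄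
      ...     | inj₁ x = inj₂ (inj₂ (inj₁ (both x)))
      ...     | inj₂ x = inj₂ (inj₂ (inj₂ (both x)))

    from : ∀ p q → p ≢ q → E c p q →
      ((suc p ≡ᵇ q) ∨ (suc q ≡ᵇ p) ∨ ((p ≡ᵇ 0) ∧ (q ≡ᵇ κ)) ∨ ((q ≡ᵇ 0) ∧ (p ≡ᵇ κ))) ≡ true
    from zero zero p≢q e = ⊥-elim (p≢q refl)
    from zero (suc q) p≢q e with ends e
    ... | inj₁ refl = refl
    ... | inj₂ refl = ∨-true⁺ʳ {1 ≡ᵇ suc q} (∨-true⁺ˡ (≡ᵇ-true⁺ {κ} refl))
    from (suc p) zero p≢q e with ends (E-sym e)
    ... | inj₁ refl = refl
    ... | inj₂ refl = ∨-true⁺ʳ {1 ≡ᵇ suc p} (≡ᵇ-true⁺ {κ} refl)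
    from (suc p) (suc q) p≢q e with <-cmp p q
    ... | tri< p<q _ _ = ∨-true⁺ˡ (≡ᵇ-true⁺ (≤-antisym p<q (short e)))
    ... | tri≈ _ p≡q _ = ⊥-elim (p≢q (cong suc p≡q))
    ... | tri> _ _ q<p = ∨-true⁺ʳ {suc p ≡ᵇ q}
                           (∨-true⁺ˡ (≡ᵇ-true⁺ (≤-antisym q<p (short (E-sym e)))))

  K2k′-minor : ∀ {k c} → Bags (2 + k) c → E c 0 1 →
    (∀ {i} → i < k → E c 0 (2 + i)) → (∀ {i} → i < k → E c 1 (2 + i)) →
    (∀ {i j} → E c (2 + i) (2 + j) → i ≡ j) →
    ParallelMinor (K2k′ k) G
  K2k′-minor {k} {c} B e₀₁ e₀ e₁ independent =
    toMinor (K2k′ k) B to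
      (λ a≢b e → cong₂ _∧_ (not-==⁺ a≢b) (from _ _ (a≢b ∘ toℕ-injective) e))
    where
    low : ∀ p q → p ≢ q → q < 2 + k → p < 2 → E c p q
    low 0 0 p≢q _ _ = ⊥-elim (p≢q refl)
    low 0 1 _ _ _ = e₀₁
    low 0 (suc (suc q)) _ (s≤s (s≤s q<)) _ = e₀ q<
    low 1 0 _ _ _ = E-sym e₀₁
    low 1 1 p≢q _ _ = ⊥-elim (p≢q refl)
    low 1 (suc (suc q)) _ (s≤s (s≤s q<)) _ = e₁ q<
    low (suc (suc p)) _ _ _ (s≤s (s≤s ()))

    to : ∀ {a b} → Edge (K2k′ k) a b → a ≢ b × E c (toℕ a) (toℕ b)
    to {a} {b} e with ∧-true⁻ {not (a == b)} e
    ... | e₁ , e₂ with not-==⁻ {a = a} {b} e₁ | ∨-true⁻ {toℕ a <ᵇ 2} e₂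
    ... | a≢b | inj₁ x = a≢b , low _ _ (a≢b ∘ toℕ-injective) (toℕ<n b) (<ᵇ-true⁻ x)
    ... | a≢b | inj₂ x = a≢b ,
          E-sym (low _ _ (a≢b ∘ sym ∘ toℕ-injective) (toℕ<n a) (<ᵇ-true⁻ x))

    from : ∀ p q → p ≢ q → E c p q → ((p <ᵇ 2) ∨ (q <ᵇ 2)) ≡ true
    from 0 _ _ _ = refl
    from 1 _ _ _ = refl
    from (suc (suc p)) 0 _ _ = refl
    from (suc (suc p)) 1 _ _ = refl
    from (suc (suc p)) (suc (suc q)) p≢q e = ⊥-elim (p≢q (cong (2 +_) (independent e)))

-- Paths of bags with apexes, and the creation of a new apex.

module Paths (G : Graph) (symm : ∀ x y → adj G x y ≡ adj G y x) where
  open Contractions G symm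

  -- Bags 0, …, n-1 form a path; the j further bags n, …, j+n-1 are adjacent
  -- to each other and to all of the path.
  record PathNet (j n : ℕ) (c : V → ℕ) : Set where
    field
      bags : Bags (j + n) c
      path : ∀ {p} → suc p < n → E c p (suc p)
      apex : ∀ {p q} → n ≤ p → p < j + n → q < p → E c p q
  open PathNet public

  -- Both ends are required to lie on the path, so these links remain valid when the old apexes
  -- receive new labels.
  PathLink : (V → ℕ) → ℕ → (ℕ → ℕ) → ℕ → ℕ → Set
  PathLink c n γ p q = E c p q × (p < n × q < n) × γ p ≡ γ q

  PathLink-sym : ∀ {c n γ p q} → PathLink c n γ p q → PathLink c n γ q p
  PathLink-sym (e , (p< , q<) , eq) = E-sym e , (q< , p<) , sym eq

  interval : ∀ {j n c γ x y} → PathNet j n c → x ≤′ y → y < n →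
    (∀ {z} → x ≤ z → z ≤ y → γ z ≡ γ x) → Star (PathLink c n γ) x y
  interval net ≤′-refl y< const = ε
  interval {y = suc y} net (≤′-step x≤y) y< const =
    interval net x≤y (<-trans (n<1+n y) y<) (λ x≤z z≤y → const x≤z (m≤n⇒m≤1+n z≤y)) ◅◅
    ((path net y< , (<-trans (n<1+n y) y< , y<) ,
      trans (const (≤′⇒≤ x≤y) (n≤1+n y)) (sym (const (m≤n⇒m≤1+n (≤′⇒≤ x≤y)) ≤-refl))) ◅ ε)

  -- A convex fibre contains the whole stretch of path between any two of its members.
  convex-connected : ∀ {j n c γ} → PathNet j n c →
    (∀ {x y z} → x ≤ z → z ≤ y → y < n → γ x ≡ γ y → γ z ≡ γ x) →
    ∀ {x y} → x < n → y < n → γ x ≡ γ y → Star (PathLink c n γ) x y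
  convex-connected net convex {x} {y} x< y< eq with ≤-total x y
  ... | inj₁ x≤y = interval net (≤⇒≤′ x≤y) y< (λ x≤z z≤y → convex x≤z z≤y y< eq)
  ... | inj₂ y≤x = reverse PathLink-sym
        (interval net (≤⇒≤′ y≤x) x< (λ y≤z z≤x → convex y≤z z≤x x< (sym eq)))

  PathEdge : (V → ℕ) → ℕ → (ℕ → ℕ) → ℕ → ℕ → Set
  PathEdge c n γ i k = ∃₂ λ x y → x < n × y < n × γ x ≡ i × γ y ≡ k × E c x y

  -- Label M is the new apex, the labels below M form the new path.
  record FanMap (c : V → ℕ) (n M : ℕ) (γ : ℕ → ℕ) : Set where
    field
      range     : ∀ {x} → x < n → γ x ≤ M
      connected : ∀ {x y} → x < n → y < n → γ x ≡ γ y → Star (PathLink c n γ) x y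
      rim       : ∀ {i} → suc i < M → PathEdge c n γ i (suc i)
      spoke     : ∀ {i} → i < M → PathEdge c n γ M i

  -- The old apexes are shifted to the labels above `M`. Each was adjacent to all of the old path,
  -- so it stays adjacent to every label up to `M`, all of which have a preimage on that path.
  newApex : ∀ {j n c M γ} → PathNet j n c → 0 < M → FanMap c n M γ →
    ∃ λ c′ → PathNet (suc j) M c′
  newApex {j} {n} {c} {M} {γ} net 0<M fan = Γ ∘ c , record
    { bags = relabel Γ (bags net) bd (λ {q} → onto′ {q}) cn
    ; path = λ p< → mapE (rim p<)
    ; apex = apex′
    }
    where
    open FanMap fan
    Γ : ℕ → ℕ
    Γ p with p <? n
    ... | yes _ = γ p
    ... | no  _ = suc M + (p ∸ n)

    Γ-lo : ∀ {p} → p < n → Γ p ≡ γ p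
    Γ-lo {p} p<n with p <? n
    ... | yes _ = refl
    ... | no p≮n = ⊥-elim (p≮n p<n)

    Γ-hi : ∀ {p} → n ≤ p → Γ p ≡ suc M + (p ∸ n)
    Γ-hi {p} n≤p with p <? n
    ... | yes p<n = ⊥-elim (<⇒≱ p<n n≤p)
    ... | no _ = refl

    mapE : ∀ {i k} → PathEdge c n γ i k → E (Γ ∘ c) i k
    mapE (x , y , x< , y< , refl , refl , e) =
      subst₂ (E (Γ ∘ c)) (Γ-lo x<) (Γ-lo y<) (E-map Γ e)

    bd : ∀ {p} → p < j + n → Γ p < suc j + M
    bd {p} p< with <-≤-connex p n
    ... | inj₁ p<n = subst (_< suc j + M) (sym (Γ-lo p<n)) (s≤s (≤-trans (range p<n) (m≤n+m M j)))
    ... | inj₂ n≤p = subst (_< suc j + M) (sym (Γ-hi n≤p))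
          (s≤s (subst (M + (p ∸ n) <_) (+-comm M j)
            (+-monoʳ-< M (subst (p ∸ n <_) (m+n∸n≡m j n) (∸-monoˡ-< p< n≤p)))))

    pre-lo : ∀ {q} → q ≤ M → ∃ λ p → p < n × Γ p ≡ q
    pre-lo {q} q≤M with m≤n⇒m<n∨m≡n q≤M
    ... | inj₁ q<M with spoke q<M
    ...   | x , y , x< , y< , γx , γy , _ = y , y< , trans (Γ-lo y<) γy
    -- Label `M` itself is attained only through a spoke, and there is one because `0 < M`.
    pre-lo q≤M | inj₂ refl with spoke 0<M
    ...   | x , y , x< , y< , γx , γy , _ = x , x< , trans (Γ-lo x<) γx

    pre-hi : ∀ {q} → M < q → Γ (n + (q ∸ suc M)) ≡ q
    pre-hi {q} M<q = trans (Γ-hi (m≤m+n n _))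
      (trans (cong (suc M +_) (m+n∸m≡n n _)) (m+[n∸m]≡n M<q))

    hi< : ∀ {q} → M < q → q < suc j + M → n + (q ∸ suc M) < j + n
    hi< {q} M<q q< = subst (n + (q ∸ suc M) <_) (+-comm n j) (+-monoʳ-< n
      (subst (q ∸ suc M <_) (m+n∸n≡m j (suc M))
        (∸-monoˡ-< (subst (q <_) (sym (+-suc j M)) q<) M<q)))

    onto′ : ∀ {q} → q < suc j + M → ∃ λ p → p < j + n × Γ p ≡ q
    onto′ {q} q< with ≤-<-connex q M
    ... | inj₁ q≤M = let p , p< , eq = pre-lo q≤M in p , ≤-trans p< (m≤n+m n j) , eq
    ... | inj₂ M<q = _ , hi< M<q q< , pre-hi M<q

    cn : ∀ {p q} → p < j + n → q < j + n → Γ p ≡ Γ q → Star (Link c Γ) p q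
    cn {p} {q} _ _ eq with <-≤-connex p n | <-≤-connex q n
    ... | inj₁ p< | inj₁ q< =
      Star.map (λ (e , (a< , b<) , eq) → e , trans (Γ-lo a<) (trans eq (sym (Γ-lo b<))))
        (connected p< q< (trans (sym (Γ-lo p<)) (trans eq (Γ-lo q<))))
    ... | inj₁ p< | inj₂ ≤q = ⊥-elim (<⇒≢ (s≤s (≤-trans (range p<) (m≤m+n M _)))
            (trans (sym (Γ-lo p<)) (trans eq (Γ-hi ≤q))))
    ... | inj₂ ≤p | inj₁ q< = ⊥-elim (<⇒≢ (s≤s (≤-trans (range q<) (m≤m+n M _)))
            (trans (sym (Γ-lo q<)) (trans (sym eq) (Γ-hi ≤p))))
    ... | inj₂ ≤p | inj₂ ≤q = subst (Star _ p) p≡q ε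
      where
      p≡q : p ≡ q
      p≡q = ∸-cancelʳ-≡ ≤p ≤q (+-cancelˡ-≡ (suc M) _ _
              (trans (sym (Γ-hi ≤p)) (trans eq (Γ-hi ≤q))))

    apex′ : ∀ {p q} → M ≤ p → p < suc j + M → q < p → E (Γ ∘ c) p q
    apex′ {p} {q} M≤p p< q<p with m≤n⇒m<n∨m≡n M≤p
    ... | inj₂ refl = mapE (spoke q<p)
    ... | inj₁ M<p with ≤-<-connex q M
    ...   | inj₁ q≤M = let y , y< , eq = pre-lo q≤M in
            subst₂ (E (Γ ∘ c)) (pre-hi M<p) eq
              (E-map Γ (apex net (m≤m+n n _) (hi< M<p p<) (≤-trans y< (m≤m+n n _))))
    ...   | inj₂ M<q =
            subst₂ (E (Γ ∘ c)) (pre-hi M<p) (pre-hi M<q)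
              (E-map Γ (apex net (m≤m+n n _) (hi< M<p p<) (+-monoʳ-< n (∸-monoˡ-< q<p M<q))))

-- Marked positions and the blocks they cut.

-- An increasing list of positions in `[s, e)` with property `P`, the largest outermost; the last
-- index is its length.
data Marks (P : ℕ → Set) (s : ℕ) : ℕ → ℕ → Set where
  none : ∀ {e} → s ≤ e → Marks P s e 0
  snoc : ∀ {e a p} → Marks P s a p → P a → a < e → Marks P s e (suc p)

module _ {P : ℕ → Set} where
  cons : ∀ {s b e p} → s ≤ b → P b → Marks P (suc b) e p → Marks P s e (suc p)
  cons s≤b Pb (none b<e) = snoc (none s≤b) Pb b<e
  cons s≤b Pb (snoc ms Pa a<e) = snoc (cons s≤b Pb ms) Pa a<e

  widen-end : ∀ {s e e′ p} → e ≤ e′ → Marks P s e p → Marks P s e′ p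
  widen-end e≤ (none s≤e) = none (≤-trans s≤e e≤)
  widen-end e≤ (snoc ms Pa a<e) = snoc ms Pa (≤-trans a<e e≤)

  widen-start : ∀ {s s′ e p} → s′ ≤ s → Marks P s e p → Marks P s′ e p
  widen-start s≤ (none s≤e) = none (≤-trans s≤ s≤e)
  widen-start s≤ (snoc ms Pa a<e) = snoc (widen-start s≤ ms) Pa a<e

  weaken : ∀ {Q : ℕ → Set} {s e p} → (∀ {x} → P x → Q x) → Marks P s e p → Marks Q s e p
  weaken f (none s≤e) = none s≤e
  weaken f (snoc ms Pa a<e) = snoc (weaken f ms) (f Pa) a<e

  -- The number of marks up to `x`, the first one not counted. Cutting before every mark but the
  -- first gives `suc p` blocks with one mark each; positions before the first mark join block 0.
  index : ∀ {s e p} → Marks P s e (suc p) → ℕ → ℕ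
  index (snoc (none _) _ _) x = 0
  index (snoc {a = a} {p = suc p} ms@(snoc _ _ _) _ _) x with x <? a
  ... | yes _ = index ms x
  ... | no  _ = suc p

  index≤ : ∀ {s e p} (ms : Marks P s e (suc p)) x → index ms x ≤ p
  index≤ (snoc (none _) _ _) x = z≤n
  index≤ (snoc {a = a} ms@(snoc _ _ _) _ _) x with x <? a
  ... | yes _ = m≤n⇒m≤1+n (index≤ ms x)
  ... | no  _ = ≤-refl

  index-mono : ∀ {s e p} (ms : Marks P s e (suc p)) {x y} → x ≤ y → index ms x ≤ index ms y
  index-mono (snoc (none _) _ _) x≤y = z≤n
  index-mono (snoc {a = a} ms@(snoc _ _ _) _ _) {x} {y} x≤y with x <? a | y <? a
  ... | yes _ | yes _ = index-mono ms x≤y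
  ... | yes _ | no  _ = m≤n⇒m≤1+n (index≤ ms x)
  ... | no x≮ | yes y< = ⊥-elim (x≮ (≤-<-trans x≤y y<))
  ... | no  _ | no  _ = ≤-refl

  index-top : ∀ {s e p} (ms : Marks P s e (suc p)) {x} → e ≤ suc x → index ms x ≡ p
  index-top (snoc (none _) _ _) e≤ = refl
  index-top (snoc {a = a} ms@(snoc _ _ _) _ a<e) {x} e≤ with x <? a
  ... | yes x<a = ⊥-elim (<⇒≱ x<a (≤-pred (≤-trans a<e e≤)))
  ... | no  _ = refl

  index-lo : ∀ {s a e p} (ms : Marks P s a (suc p)) {Pa : P a} {a<e : a < e} {x} →
    x < a → index (snoc ms Pa a<e) x ≡ index ms x
  index-lo {a = a} (snoc _ _ _) {x = x} x<a with x <? a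
  ... | yes _ = refl
  ... | no x≮a = ⊥-elim (x≮a x<a)

  index-hi : ∀ {s a e p} (ms : Marks P s a (suc p)) {Pa : P a} {a<e : a < e} {x} →
    a ≤ x → index (snoc ms Pa a<e) x ≡ suc p
  index-hi {a = a} (snoc _ _ _) {x = x} a≤x with x <? a
  ... | yes x<a = ⊥-elim (<⇒≱ x<a a≤x)
  ... | no _ = refl

  start≤ : ∀ {s e p} → Marks P s e p → s ≤ e
  start≤ (none s≤e) = s≤e
  start≤ (snoc ms _ a<e) = ≤-trans (start≤ ms) (<⇒≤ a<e)

  index-mark : ∀ {s e p i} (ms : Marks P s e (suc p)) → i ≤ p →
    ∃ λ x → s ≤ x × x < e × P x × index ms x ≡ i
  index-mark {i = zero} (snoc {a = a} (none s≤a) Pa a<e) z≤n = a , s≤a , a<e , Pa , refl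
  index-mark (snoc {a = a} ms@(snoc _ _ _) Pa a<e) i≤p with m≤n⇒m<n∨m≡n i≤p
  ... | inj₂ refl = a , start≤ ms , a<e , Pa , index-hi ms {Pa} {a<e} ≤-refl
  ... | inj₁ (s≤s i≤) with index-mark ms i≤
  ...   | x , s≤x , x<a , Px , eq =
          x , s≤x , <-trans x<a a<e , Px , trans (index-lo ms {Pa} {a<e} x<a) eq

  -- The next block begins at a mark, so the position just before that mark ends block `i`. These
  -- pairs supply the rim edges.
  index-step : ∀ {s e p i} (ms : Marks P s e (suc p)) → i < p →
    ∃ λ x → s ≤ x × suc x < e × index ms x ≡ i × index ms (suc x) ≡ suc i
  index-step (snoc {a = suc x} ms@(snoc mt _ b<a) Pa a<e) (s≤s i≤) with m≤n⇒m<n∨m≡n i≤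
  ... | inj₂ refl = x , ≤-trans (start≤ mt) (≤-pred b<a) , a<e ,
          trans (index-lo ms {Pa} {a<e} ≤-refl) (index-top ms ≤-refl) ,
          index-hi ms {Pa} {a<e} ≤-refl
  ... | inj₁ i< with index-step ms i<
  ...   | y , s≤y , y< , e₁ , e₂ = y , s≤y , <-trans y< a<e ,
          trans (index-lo ms {Pa} {a<e} (<-trans (n<1+n y) y<)) e₁ ,
          trans (index-lo ms {Pa} {a<e} y<) e₂

-- Nested intervals: a new apex or a stretch of short edges.

module Nesting (G : Graph) (symm : ∀ x y → adj G x y ≡ adj G y x) where
  open Contractions G symm
  open Paths G symm

  Right : (V → ℕ) → ℕ → ℕ → ℕ → Set
  Right c n h x = ∃ λ y → h ≤ y × y < n × E c x y

  Left : (V → ℕ) → ℕ → ℕ → Set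
  Left c l x = ∃ λ y → y ≤ l × E c y x

  -- All of the path to the right of `l` becomes the apex. Each block of `[0, l]` holds a mark,
  -- whose neighbour at or beyond `h` gives the spoke.
  right-fan : ∀ {j n c l h m} → PathNet j n c → l < h → h < n →
    Marks (Right c n h) 0 (suc l) (suc m) → ∃ λ c′ → PathNet (suc j) (suc m) c′
  right-fan {n = n} {c} {l} {h} {m} net l<h h<n ms = newApex net z<s record
    { range = λ {x} _ → range x
    ; connected = convex-connected net convex
    ; rim = rim
    ; spoke = spoke
    }
    where
    M = suc m
    γ : ℕ → ℕ
    γ x with x ≤? l
    ... | yes _ = index ms x
    ... | no  _ = M

    γ-lo : ∀ {x} → x ≤ l → γ x ≡ index ms x
    γ-lo {x} x≤l with x ≤? l
    ... | yes _ = refl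
    ... | no x≰l = ⊥-elim (x≰l x≤l)

    γ-hi : ∀ {x} → l < x → γ x ≡ M
    γ-hi {x} l<x with x ≤? l
    ... | yes x≤l = ⊥-elim (<⇒≱ l<x x≤l)
    ... | no _ = refl

    range : ∀ x → γ x ≤ M
    range x with x ≤? l
    ... | yes _ = m≤n⇒m≤1+n (index≤ ms x)
    ... | no  _ = ≤-refl

    mono : ∀ {x y} → x ≤ y → γ x ≤ γ y
    mono {x} {y} x≤y with x ≤? l | y ≤? l
    ... | yes _ | yes _ = index-mono ms x≤y
    ... | yes _ | no  _ = m≤n⇒m≤1+n (index≤ ms x)
    ... | no x≰ | yes y≤ = ⊥-elim (x≰ (≤-trans x≤y y≤))
    ... | no  _ | no  _ = ≤-refl

    convex : ∀ {x y z} → x ≤ z → z ≤ y → y < n → γ x ≡ γ y → γ z ≡ γ x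
    convex x≤z z≤y _ eq = ≤-antisym (≤-trans (mono z≤y) (≤-reflexive (sym eq))) (mono x≤z)

    rim : ∀ {i} → suc i < M → PathEdge c n γ i (suc i)
    rim (s≤s i<) with index-step ms i<
    ... | x , _ , s≤s x< , e₁ , e₂ = x , suc x ,
          <-trans (n<1+n x) sx<n , sx<n ,
          trans (γ-lo (<⇒≤ x<)) e₁ , trans (γ-lo x<) e₂ , path net sx<n
      where
      sx<n : suc x < n
      sx<n = ≤-<-trans x< (<-trans l<h h<n)

    spoke : ∀ {i} → i < M → PathEdge c n γ M i
    spoke (s≤s i≤) with index-mark ms i≤
    ... | x , _ , s≤s x≤l , (y , h≤y , y<n , e) , eq =
          y , x , y<n , ≤-<-trans x≤l (<-trans l<h h<n) ,
          γ-hi (≤-trans l<h h≤y) , trans (γ-lo x≤l) eq , E-sym e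

  -- Mirror image of `right-fan`: the part before `h` becomes the apex and `[h, n)` is cut into
  -- blocks.
  left-fan : ∀ {j n c l h m} → PathNet j n c → l < h →
    Marks (Left c l) h n (suc m) → ∃ λ c′ → PathNet (suc j) (suc m) c′
  left-fan {n = n} {c} {l} {h} {m} net l<h ms = newApex net z<s record
    { range = λ {x} _ → range x
    ; connected = convex-connected net convex
    ; rim = rim
    ; spoke = spoke
    }
    where
    M = suc m
    γ : ℕ → ℕ
    γ x with x <? h
    ... | yes _ = M
    ... | no  _ = index ms x

    γ-lo : ∀ {x} → x < h → γ x ≡ M
    γ-lo {x} x<h with x <? h
    ... | yes _ = refl
    ... | no x≮h = ⊥-elim (x≮h x<h)

    γ-hi : ∀ {x} → h ≤ x → γ x ≡ index ms x
    γ-hi {x} h≤x with x <? h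
    ... | yes x<h = ⊥-elim (<⇒≱ x<h h≤x)
    ... | no _ = refl

    range : ∀ x → γ x ≤ M
    range x with x <? h
    ... | yes _ = ≤-refl
    ... | no  _ = m≤n⇒m≤1+n (index≤ ms x)

    convex : ∀ {x y z} → x ≤ z → z ≤ y → y < n → γ x ≡ γ y → γ z ≡ γ x
    convex {x} {y} {z} x≤z z≤y _ eq with x <? h | y <? h | z <? h
    ... | yes _ | yes _ | yes _ = refl
    ... | yes _ | yes y< | no z≮ = ⊥-elim (z≮ (≤-<-trans z≤y y<))
    ... | yes _ | no _ | _ = ⊥-elim (<⇒≢ (s≤s (index≤ ms y)) (sym eq))
    ... | no x≮ | _ | yes z< = ⊥-elim (x≮ (≤-<-trans x≤z z<))
    ... | no x≮ | yes y< | no _ = ⊥-elim (x≮ (≤-<-trans (≤-trans x≤z z≤y) y<))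
    ... | no _ | no _ | no _ = ≤-antisym
            (≤-trans (index-mono ms z≤y) (≤-reflexive (sym eq))) (index-mono ms x≤z)

    rim : ∀ {i} → suc i < M → PathEdge c n γ i (suc i)
    rim (s≤s i<) with index-step ms i<
    ... | x , h≤x , sx<n , e₁ , e₂ = x , suc x , <-trans (n<1+n x) sx<n , sx<n ,
          trans (γ-hi h≤x) e₁ , trans (γ-hi (m≤n⇒m≤1+n h≤x)) e₂ , path net sx<n

    spoke : ∀ {i} → i < M → PathEdge c n γ M i
    spoke (s≤s i≤) with index-mark ms i≤
    ... | x , h≤x , x<n , (y , y≤l , e) , eq =
          y , x , <-trans (≤-<-trans y≤l l<h) (≤-<-trans h≤x x<n) , x<n ,
          γ-lo (≤-<-trans y≤l l<h) , trans (γ-hi h≤x) eq , e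

  -- Room for `κ` pieces of length `D` strictly inside `[l, h]`. Every path edge meeting it has
  -- length below `D`, so it cannot skip a piece; edges to apexes are exempt through `y < n`.
  record Stretch (c : V → ℕ) (n κ l h : ℕ) : Set where
    field
      D σ    : ℕ
      D>0    : 0 < D
      l<σ    : l < σ
      σ+κD<h : σ + κ * D < h
      short  : ∀ {x y} → σ ≤ x → x < σ + κ * D → y < n → E c x y →
               y < x + D × x < y + D

  shrink : ∀ {c n κ l l′ h h′} → l ≤ l′ → h′ ≤ h → Stretch c n κ l′ h′ → Stretch c n κ l h
  shrink l≤ h≤ s = record
    { D = D ; σ = σ ; D>0 = D>0 ; short = short
    ; l<σ = ≤-<-trans l≤ l<σ ; σ+κD<h = <-≤-trans σ+κD<h h≤ }
    where open Stretch s

  -- Every edge that spans a D-long part of [l, h] but has an end strictly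
  -- inside replaces [l, h] by that part and contributes its end as a mark.
  nest : ∀ {j n c} → PathNet j n c → ∀ κ m p q {w l α β} →
    w ≡ (2 + κ) ^ (p + q) → α + p ≡ suc m → β + q ≡ suc m → l + w < n →
    Marks (Right c n (l + w)) 0 (suc l) α → Marks (Left c l) (l + w) n β →
    (∃ λ c′ → PathNet (suc j) (suc m) c′) ⊎ Stretch c n κ l (l + w)
  -- `p` and `q` count the right and left marks still missing; once either is zero, that side has
  -- its `suc m` marks.
  nest net κ m zero q {w} {l} {α} refl eα eβ h<n ms ms′
    with refl ← trans (sym (+-identityʳ α)) eα =
    inj₁ (right-fan net (m<m+n l (m^n>0 (2 + κ) q)) h<n ms)
  nest net κ m (suc p) zero {w} {l} {α} {β} refl eα eβ h<n ms ms′
    with refl ← trans (sym (+-identityʳ β)) eβ =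
    inj₁ (left-fan net (m<m+n l (m^n>0 (2 + κ) (suc p + 0))) ms′)
  nest {n = n} {c} net κ m (suc p) (suc q) {w} {l} {α} {β} refl eα eβ h<n ms ms′ =
    step₁ (anyUpTo? (λ a → (l <? a) ×-dec (a + D ≤? h) ×-dec
             anyUpTo? (λ b → (a + D ≤? b) ×-dec E? c a b) n) n)
    where
    -- The interval has length `(2 + κ) * D`: a margin `D` at either end and `κ * D` between. From
    -- any middle position a part of length `D` in either direction stays inside `[l, h]`.
    D = (2 + κ) ^ (p + suc q)
    h = l + (2 + κ) * D
    σ = l + D
    D>0 : 0 < D
    D>0 = m^n>0 (2 + κ) (p + suc q)

    h≡ : h ≡ (σ + κ * D) + D
    h≡ = begin
      l + (D + (D + κ * D))   ≡⟨ +-assoc l D _ ⟨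
      σ + (D + κ * D)         ≡⟨ cong (σ +_) (+-comm D _) ⟩
      σ + (κ * D + D)         ≡⟨ +-assoc σ _ D ⟨
      (σ + κ * D) + D         ∎
      where open ≡-Reasoning

    σ+κD<h : σ + κ * D < h
    σ+κD<h = subst (σ + κ * D <_) (sym h≡) (m<m+n _ D>0)

    Result : Set
    Result = (∃ λ c′ → PathNet _ (suc m) c′) ⊎ Stretch c n κ l h

    -- In both cases the new interval is `[a, a + D]`; the new mark is its left end for `Longʳ`, its
    -- right end for `Longˡ`. The strict bounds `l < a` and `a + D < h` keep the marks distinct.
    Longʳ = ∃ λ a → a < n × l < a × a + D ≤ h × (∃ λ b → b < n × a + D ≤ b × E c a b)
    Longˡ = ∃ λ a → a < n × l ≤ a × a + D < h × (∃ λ b → b < n × b ≤ a × E c b (a + D))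

    step₂ : ¬ Longʳ → Dec Longˡ → Result
    step₂ _ (yes (a , _ , l≤a , aD<h , b , _ , b≤a , e))
      with nest net κ m (suc p) q {α = α} (cong ((2 + κ) ^_) (+-suc p q)) eα
             (trans (sym (+-suc β q)) eβ) (<-trans aD<h h<n)
             (widen-end (s≤s l≤a) (weaken (λ (y , h≤y , r) → y , ≤-trans (<⇒≤ aD<h) h≤y , r) ms))
             (cons ≤-refl (b , b≤a , e)
               (weaken (λ (y , y≤l , e) → y , ≤-trans y≤l l≤a , e) (widen-start aD<h ms′)))
    ... | inj₁ r = inj₁ r
    ... | inj₂ s = inj₂ (shrink l≤a (<⇒≤ aD<h) s)
    step₂ ¬r (no ¬l) = inj₂ record
      { D = D ; σ = σ ; D>0 = D>0 ; l<σ = m<m+n l D>0 ; σ+κD<h = σ+κD<h ; short = short }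
      where
      short : ∀ {x y} → σ ≤ x → x < σ + κ * D → y < n → E c x y → y < x + D × x < y + D
      short {x} {y} σ≤x x< y<n e =
        ≰⇒> (λ long → ¬r (x , <-trans x<h h<n , <-≤-trans (m<m+n l D>0) σ≤x ,
               subst (x + D ≤_) (sym h≡) (+-monoˡ-≤ D (<⇒≤ x<)) , y , y<n , long , e)) ,
        ≰⇒> (λ long → ¬l (x ∸ D , ≤-<-trans (m∸n≤m x D) (<-trans x<h h<n) ,
               subst (_≤ x ∸ D) (m+n∸n≡m l D) (∸-monoˡ-≤ D σ≤x) ,
               subst (_< h) (sym x≡) x<h , y , y<n ,
               subst (_≤ x ∸ D) (m+n∸n≡m y D) (∸-monoˡ-≤ D long) ,
               subst (E c y) (sym x≡) (E-sym e)))
        where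
        x<h : x < h
        x<h = <-trans x< σ+κD<h
        x≡ : (x ∸ D) + D ≡ x
        x≡ = m∸n+n≡m (≤-trans (m≤n+m D l) σ≤x)

    step₁ : Dec Longʳ → Result
    step₁ (yes (a , _ , l<a , aD≤h , b , b<n , aD≤b , e))
      with nest net κ m p (suc q) {β = β} refl (trans (sym (+-suc α p)) eα) eβ
             (≤-<-trans aD≤h h<n)
             (snoc (weaken (λ (y , h≤y , r) → y , ≤-trans aD≤h h≤y , r) (widen-end l<a ms))
               (b , aD≤b , b<n , e) (n<1+n a))
             (weaken (λ (y , y≤l , e) → y , ≤-trans y≤l (<⇒≤ l<a) , e) (widen-start aD≤h ms′))
    ... | inj₁ r = inj₁ r
    ... | inj₂ s = inj₂ (shrink (<⇒≤ l<a) aD≤h s)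
    step₁ (no ¬r) = step₂ ¬r
      (anyUpTo? (λ a → (l ≤? a) ×-dec (a + D <? h) ×-dec
         anyUpTo? (λ b → (b ≤? a) ×-dec E? c b (a + D)) n) n)

-- A path of suc (fanLength k r) bags suffices to gain r further apexes.
fanLength : ℕ → ℕ → ℕ
fanLength k zero    = 0
fanLength k (suc r) = (2 + k) ^ (suc (fanLength k r) + suc (fanLength k r))

-- Cutting a stretch into pieces: fans, cycles and complete graphs.

module Pieces (G : Graph) (symm : ∀ x y → adj G x y ≡ adj G y x) where
  open Contractions G symm
  open Targets G symm
  open Paths G symm
  open Nesting G symm

  quotient : ∀ {r i D} .{{_ : NonZero D}} → i * D ≤ r → r < suc i * D → r / D ≡ i
  quotient {r} {i} {D} lo hi = ≤-antisym (≤-pred (m<n*o⇒m/o<n hi))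
    (subst (_≤ r / D) (m*n/n≡m i D) (/-monoˡ-≤ D lo))

  next-quotient : ∀ r D .{{_ : NonZero D}} → (r + D) / D ≡ suc (r / D)
  next-quotient r D = trans (m/n≡1+[m∸n]/n (m≤n+m D r)) (cong (λ z → suc (z / D)) (m+n∸n≡m r D))

  module Cut {j n c κ l h} (net : PathNet j n c) (h≤n : h ≤ n) (κ>0 : 0 < κ)
             (stretch : Stretch c n κ l h) where
    open Stretch stretch

    instance
      D≢0 : NonZero D
      D≢0 = >-nonZero D>0

    τ : ℕ
    τ = σ + κ * D

    τ<n : τ < n
    τ<n = <-≤-trans σ+κD<h h≤n

    σ<τ : σ < τ
    σ<τ = m<m+n σ (*-mono-< κ>0 D>0)

    -- Label 0 collects everything outside `[σ, τ)`, including any apexes, since their labels are at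
    -- least `n`; the pieces are numbered from 1.
    γ : ℕ → ℕ
    γ p with p <? σ | p <? τ
    ... | yes _ | _     = 0
    ... | no  _ | yes _ = suc ((p ∸ σ) / D)
    ... | no  _ | no  _ = 0

    γ-lo : ∀ {p} → p < σ → γ p ≡ 0
    γ-lo {p} p<σ with p <? σ
    ... | yes _ = refl
    ... | no p≮ = ⊥-elim (p≮ p<σ)

    γ-hi : ∀ {p} → τ ≤ p → γ p ≡ 0
    γ-hi {p} τ≤p with p <? σ | p <? τ
    ... | yes _ | _ = refl
    ... | no _ | yes p<τ = ⊥-elim (<⇒≱ p<τ τ≤p)
    ... | no _ | no _ = refl

    γ-in : ∀ {r} → r < κ * D → γ (σ + r) ≡ suc (r / D)
    γ-in {r} r< with σ + r <? σ | σ + r <? τ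
    ... | yes lt | _ = ⊥-elim (m+n≮m σ r lt)
    ... | no _ | yes _ = cong (λ z → suc (z / D)) (m+n∸m≡n σ r)
    ... | no _ | no ≮τ = ⊥-elim (≮τ (+-monoʳ-< σ r<))

    data Place : ℕ → Set where
      below  : ∀ {p} → p < σ → Place p
      inside : ∀ r → r < κ * D → Place (σ + r)
      above  : ∀ {p} → τ ≤ p → Place p

    place : ∀ p → Place p
    place p with <-≤-connex p σ | <-≤-connex p τ
    ... | inj₁ p<σ | _ = below p<σ
    ... | inj₂ _   | inj₂ τ≤p = above τ≤p
    ... | inj₂ σ≤p | inj₁ p<τ = subst Place (m+[n∸m]≡n σ≤p)
            (inside (p ∸ σ) (+-cancelˡ-< σ _ _ (subst (_< τ) (sym (m+[n∸m]≡n σ≤p)) p<τ)))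

    piece : ∀ {p i} → γ p ≡ suc i → ∃ λ r → r < κ * D × σ + r ≡ p × r / D ≡ i
    piece {p} eq with place p
    ... | below p<σ with () ← trans (sym (γ-lo p<σ)) eq
    ... | above τ≤p with () ← trans (sym (γ-hi τ≤p)) eq
    ... | inside r r< = r , r< , refl , suc-injective (trans (sym (γ-in r<)) eq)

    outer : ∀ {p} → γ p ≡ 0 → p < σ ⊎ τ ≤ p
    outer {p} eq with place p
    ... | below p<σ = inj₁ p<σ
    ... | above τ≤p = inj₂ τ≤p
    ... | inside r r< with () ← trans (sym (γ-in r<)) eq

    i*D< : ∀ {i} → i < κ → i * D < κ * D
    i*D< = *-monoˡ-< D

    γ-start : ∀ {i} → i < κ → γ (σ + i * D) ≡ suc i
    γ-start {i} i<κ = trans (γ-in (i*D< i<κ)) (cong suc (m*n/n≡m i D))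

    inside<n : ∀ {r} → r < κ * D → σ + r < n
    inside<n r< = <-trans (+-monoʳ-< σ r<) τ<n

    -- pred (suc i * D) is the last offset of the i-th piece.
    last< : ∀ {i} → i < κ → pred (suc i * D) < κ * D
    last< {i} i<κ = <-≤-trans (pred< (suc i * D)) (*-monoˡ-≤ D i<κ)
      where
      pred< : ∀ m .{{_ : NonZero m}} → pred m < m
      pred< (suc m) = ≤-refl
      instance
        _ : NonZero (suc i * D)
        _ = m*n≢0 (suc i) D

    γ-last : ∀ {i} → i < κ → γ (σ + pred (suc i * D)) ≡ suc i
    γ-last {i} i<κ = trans (γ-in (last< i<κ)) (cong suc (quotient lo hi))
      where
      instance
        _ : NonZero (suc i * D)
        _ = m*n≢0 (suc i) D
      hi : pred (suc i * D) < suc i * D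
      hi = ≤-reflexive (suc-pred (suc i * D))
      lo : i * D ≤ pred (suc i * D)
      lo = ≤-pred (subst (i * D <_) (sym (suc-pred (suc i * D))) (m<n+m (i * D) D>0))

    suc-last : ∀ i → suc (σ + pred (suc i * D)) ≡ σ + suc i * D
    suc-last i = trans (sym (+-suc σ _)) (cong (σ +_) (suc-pred (suc i * D)))
      where
      instance
        _ : NonZero (suc i * D)
        _ = m*n≢0 (suc i) D

    last-edge : ∀ {i} → i < κ → E c (σ + pred (suc i * D)) (σ + suc i * D)
    last-edge {i} i<κ = subst (E c _) (suc-last i)
      (path net (subst (_< n) (sym (suc-last i))
        (≤-<-trans (+-monoʳ-≤ σ (*-monoˡ-≤ D i<κ)) τ<n)))

    rim : ∀ {i} → suc i < κ → E (γ ∘ c) (suc i) (suc (suc i))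
    rim {i} si<κ = subst₂ (E (γ ∘ c)) (γ-last (<-trans (n<1+n i) si<κ)) (γ-start si<κ)
      (E-map γ (last-edge (<-trans (n<1+n i) si<κ)))

    -- Offsets of adjacent positions differ by less than `D`, so their quotients by `D` differ by at
    -- most one.
    short-pieces : ∀ {i k} → E (γ ∘ c) (suc i) (suc k) → k ≤ suc i
    short-pieces e with E-unmap γ e
    ... | p , q , γp , γq , e′ with piece γp | piece γq
    ... | r , r< , refl , refl | s , s< , refl , refl =
      subst (s / D ≤_) (next-quotient r D) (/-monoˡ-≤ D (<⇒≤ s<r+D))
      where
      s<r+D : s < r + D
      s<r+D = +-cancelˡ-< σ _ _ (subst (σ + s <_) (+-assoc σ r D)
        (proj₁ (short (m≤m+n σ r) (+-monoʳ-< σ r<) (inside<n s<) e′)))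

    const-run : ∀ {r s} → r ≤ s → s < κ * D → r / D ≡ s / D →
      Star (Link c γ) (σ + r) (σ + s)
    const-run {r} {s} r≤s s< eq = Star.map (λ (e , _ , eq) → e , eq)
      (interval net (≤⇒≤′ (+-monoʳ-≤ σ r≤s)) (inside<n s<) const)
      where
      const : ∀ {z} → σ + r ≤ z → z ≤ σ + s → γ z ≡ γ (σ + r)
      const {z} lo hi with place z
      ... | below z<σ = ⊥-elim (<⇒≱ z<σ (≤-trans (m≤m+n σ r) lo))
      ... | above τ≤z = ⊥-elim (<⇒≱ (≤-<-trans hi (+-monoʳ-< σ s<)) τ≤z)
      ... | inside t t< = trans (γ-in t<) (trans (cong suc t/D) (sym (γ-in (≤-<-trans r≤s s<))))
        where
        t/D : t / D ≡ r / D
        t/D = ≤-antisym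
          (≤-trans (/-monoˡ-≤ D (+-cancelˡ-≤ σ _ _ hi)) (≤-reflexive (sym eq)))
          (/-monoˡ-≤ D (+-cancelˡ-≤ σ _ _ lo))

    -- The pieces are intervals and thus connected. Bag 0 is not an interval, so its connection to
    -- `o` has to be supplied.
    cut-bags : ∀ {o} → o < j + n → γ o ≡ 0 →
      (∀ {p} → p < j + n → γ p ≡ 0 → Star (Link c γ) p o) → Bags (suc κ) (γ ∘ c)
    cut-bags {o} o< γo hub = relabel γ (bags net) bd on cn
      where
      bd : ∀ {p} → p < j + n → γ p < suc κ
      bd {p} _ with place p
      ... | below p<σ = subst (_< suc κ) (sym (γ-lo p<σ)) z<s
      ... | above τ≤p = subst (_< suc κ) (sym (γ-hi τ≤p)) z<s
      ... | inside r r< = subst (_< suc κ) (sym (γ-in r<)) (s≤s (m<n*o⇒m/o<n r<))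

      on : ∀ {q} → q < suc κ → ∃ λ p → p < j + n × γ p ≡ q
      on {zero} _ = o , o< , γo
      on {suc i} (s≤s i<κ) = σ + i * D , ≤-trans (inside<n (i*D< i<κ)) (m≤n+m n j) , γ-start i<κ

      cn : ∀ {p q} → p < j + n → q < j + n → γ p ≡ γ q → Star (Link c γ) p q
      cn {p} {q} p< q< eq with γ p in γp
      ... | zero = hub p< γp ◅◅ reverse Link-sym (hub q< (sym eq))
      ... | suc i with piece γp | piece (sym eq)
      ...   | r , r< , refl , refl | s , s< , refl , eq′ with ≤-total r s
      ...     | inj₁ r≤s = const-run r≤s s< (sym eq′)
      ...     | inj₂ s≤r = reverse Link-sym (const-run s≤r r< eq′)

  -- The apex `n` is adjacent to everything, so it holds bag 0 together and gives all spokes.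
  stretch-fan : ∀ {j n c k l h} → PathNet (suc j) n c → h ≤ n → 0 < k → Stretch c n k l h →
    ParallelMinor (Fₖ k) G
  stretch-fan {j} {n} {c} {k} net h≤n k>0 stretch =
    fan-minor (cut-bags n< γn hub) spoke rim short-pieces
    where
    open Cut net h≤n k>0 stretch
    n< : n < suc j + n
    n< = s≤s (m≤n+m n j)
    γn : γ n ≡ 0
    γn = γ-hi (<⇒≤ τ<n)

    hub : ∀ {p} → p < suc j + n → γ p ≡ 0 → Star (Link c γ) p n
    hub {p} p< γp with <-cmp p n
    ... | tri< p<n _ _ = (E-sym (apex net ≤-refl n< p<n) , trans γp (sym γn)) ◅ ε
    ... | tri≈ _ refl _ = ε
    ... | tri> _ _ n<p = (apex net (<⇒≤ n<p) p< n<p , trans γp (sym γn)) ◅ ε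

    spoke : ∀ {i} → i < k → E (γ ∘ c) 0 (suc i)
    spoke i<k = subst₂ (E (γ ∘ c)) γn (γ-start i<k)
      (E-map γ (apex net ≤-refl n< (inside<n (i*D< i<k))))

  -- The edge from `u` to `w` joins the two ends of the path left over outside the stretch into bag
  -- 0. Shortness lets this bag touch only the first and the last piece.
  stretch-cycle : ∀ {n c κ l h u w} → PathNet 0 n c → u ≤ l → h ≤ w → w < n → E c u w →
    0 < κ → Stretch c n κ l h → ParallelMinor (Cₖ (suc κ)) G
  stretch-cycle {n} {c} {κ@(suc κ′)} {l} {h} {u} {w} net u≤l h≤w w<n span κ>0 stretch =
    cycle-minor κ>0 (cut-bags u<n (γ-lo u<σ) hub) rim′ close short-pieces ends
    where
    open Stretch stretch
    open Cut net (≤-trans h≤w (<⇒≤ w<n)) κ>0 stretch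
    u<σ : u < σ
    u<σ = ≤-<-trans u≤l l<σ
    u<n : u < n
    u<n = <-trans u<σ (<-trans σ<τ τ<n)
    τ≤w : τ ≤ w
    τ≤w = ≤-trans (<⇒≤ σ+κD<h) h≤w

    run : ∀ {x y} → x ≤ y → y < n → (∀ {z} → x ≤ z → z ≤ y → γ z ≡ 0) → Star (Link c γ) x y
    run x≤y y<n zeros = Star.map (λ (e , _ , eq) → e , eq) (interval net (≤⇒≤′ x≤y) y<n
      (λ x≤z z≤y → trans (zeros x≤z z≤y) (sym (zeros ≤-refl x≤y))))

    run± : ∀ {x y} → x < n → y < n → (∀ {z} → (z ≤ x ⊎ z ≤ y) → (x ≤ z ⊎ y ≤ z) → γ z ≡ 0) →
      Star (Link c γ) x y
    run± {x} {y} x<n y<n zeros with ≤-total x y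
    ... | inj₁ x≤y = run x≤y y<n (λ x≤z z≤y → zeros (inj₂ z≤y) (inj₁ x≤z))
    ... | inj₂ y≤x = reverse Link-sym (run y≤x x<n (λ y≤z z≤x → zeros (inj₁ z≤x) (inj₂ y≤z)))

    hub : ∀ {p} → p < n → γ p ≡ 0 → Star (Link c γ) p u
    hub p<n γp with outer γp
    ... | inj₁ p<σ = run± p<n u<n
            (λ up _ → γ-lo ([ (λ z≤p → ≤-<-trans z≤p p<σ) , (λ z≤u → ≤-<-trans z≤u u<σ) ]′ up))
    ... | inj₂ τ≤p = run± p<n w<n (λ _ dn → γ-hi ([ ≤-trans τ≤p , ≤-trans τ≤w ]′ dn)) ◅◅
            ((E-sym span , trans (γ-hi τ≤w) (sym (γ-lo u<σ))) ◅ ε)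

    rim′ : ∀ {p} → p < κ → E (γ ∘ c) p (suc p)
    rim′ {zero} _ = subst₂ (E (γ ∘ c)) (γ-lo (≤-reflexive (suc-pred σ)))
      (trans (cong γ (trans (suc-pred σ) (sym (+-identityʳ σ)))) (γ-start κ>0))
      (E-map γ (path net (subst (_< n) (sym (suc-pred σ)) (<-trans σ<τ τ<n))))
      where
      instance
        _ : NonZero σ
        _ = >-nonZero (≤-<-trans z≤n l<σ)
    rim′ {suc i} si<κ = rim si<κ

    close : E (γ ∘ c) κ 0
    close = subst₂ (E (γ ∘ c)) (γ-last (n<1+n κ′)) (γ-hi ≤-refl) (E-map γ (last-edge (n<1+n κ′)))

    ends : ∀ {i} → E (γ ∘ c) 0 (suc i) → i ≡ 0 ⊎ suc i ≡ κ
    ends {i} e with E-unmap γ e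
    ... | p , q , γp , γq , e′ with piece γq
    ... | r , r< , refl , refl
      with short (m≤m+n σ r) (+-monoʳ-< σ r<) (proj₁ (E-bound (bags net) e′)) (E-sym e′) | outer γp
    ... | _ , q<p+D | inj₁ p<σ = inj₁ (m<n⇒m/n≡0 (+-cancelˡ-< σ _ _ (<-trans q<p+D (+-monoˡ-< D p<σ))))
    ... | p<q+D , _ | inj₂ τ≤p = inj₂ (≤-antisym (m<n*o⇒m/o<n r<)
          (subst₂ _≤_ (m*n/n≡m κ D) (next-quotient r D) (/-monoˡ-≤ D (<⇒≤
            (+-cancelˡ-< σ _ _ (subst (τ <_) (+-assoc σ r D) (≤-<-trans τ≤p p<q+D)))))))

  -- Induction on the number `r` of apexes still wanted: each round finds a stretch, which together
  -- with an apex gives the fan, or gains one apex.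
  apexes : ∀ k r {j c} → PathNet (suc j) (suc (fanLength k r)) c → 2 + j + r ≡ k →
    ParallelMinor (Fₖ k) G ⊎ ParallelMinor (Kₖ k) G
  -- Here `fanLength k zero` is 0: the path is a single bag, which with `suc j` apexes makes `2 + j`
  -- mutually adjacent bags.
  apexes k zero {j} {c} net refl = inj₂ (complete-minor (subst (λ m → Bags m c) eq (bags net))
    (λ { {zero} _ ()
       ; {suc p} p< q<p → apex net (s≤s z≤n) (subst (suc p <_) (sym eq) p<) q<p }))
    where
    eq : suc j + 1 ≡ 2 + j + 0
    eq = cong suc (trans (+-comm j 1) (cong suc (sym (+-identityʳ j))))
  apexes k (suc r) {j} net refl
    with nest net k (fanLength k r) (suc (fanLength k r)) (suc (fanLength k r))
           {l = 0} {α = 0} {β = 0} refl refl refl ≤-refl (none z≤n) (none (n≤1+n _))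
  ... | inj₂ stretch = inj₁ (stretch-fan net (n≤1+n _) z<s stretch)
  ... | inj₁ (c′ , net′) = apexes k r net′ (cong (2 +_) (sym (+-suc j r)))

-- The first apex: chains of jumping edges and squares of paths.

greatest : ∀ {P : ℕ → Set} → (∀ y → Dec (P y)) → ∀ n → (∃ λ y → y < n × P y) →
  ∃ λ y → y < n × P y × (∀ {z} → z < n → P z → z ≤ y)
greatest P? zero (_ , () , _)
greatest P? (suc n) (y , y< , Py) with P? n
... | yes Pn = n , n<1+n n , Pn , λ z< _ → ≤-pred z<
... | no ¬Pn with greatest P? n (y , ≤∧≢⇒< (≤-pred y<) (λ { refl → ¬Pn Py }) , Py)
...   | x , x< , Px , max = x , m≤n⇒m≤1+n x< , Px ,
        λ z< Pz → max (≤∧≢⇒< (≤-pred z<) (λ { refl → ¬Pn Pz })) Pz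

even-or-odd : ∀ p → (∃ λ i → p ≡ 2 * i) ⊎ (∃ λ i → p ≡ suc (2 * i))
even-or-odd zero = inj₁ (0 , refl)
even-or-odd (suc p) with even-or-odd p
... | inj₁ (i , refl) = inj₂ (i , refl)
... | inj₂ (i , refl) = inj₁ (suc i , sym (*-suc 2 i))

-- Room for `2 * m` chain steps, each advancing the end by at most the power. That power is the
-- interval length from which `nest` can collect `suc m` marks on a side.
chainLength : ℕ → ℕ → ℕ
chainLength κ m = 2 * m * (2 + κ) ^ (suc m + suc m)

module Chains (G : Graph) (symm : ∀ x y → adj G x y ≡ adj G y x) where
  open Contractions G symm
  open Paths G symm
  open Nesting G symm
  open Pieces G symm

  Jumps : (V → ℕ) → ℕ → Set
  Jumps c n = ∀ {i} → 0 < i → suc i < n → ∃₂ λ p q → p < i × i < q × E c p q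

  -- The square of a path as a spanning subgraph; further edges are allowed.
  record Square (m : ℕ) (c : V → ℕ) : Set where
    field
      net  : PathNet 0 m c
      skip : ∀ {p} → suc (suc p) < m → E c p (suc (suc p))

  -- Skip edges connect the odd labels to each other and form the rim on the even ones; path edges
  -- from odd to even labels are the spokes.
  square-fan : ∀ {m c} → Square (2 * suc m) c → ∃ λ c′ → PathNet 1 (suc m) c′
  square-fan {m} {c} sq = newApex net z<s record
    { range = range ; connected = connected ; rim = rim ; spoke = spoke }
    where
    open Square sq
    M = suc m
    n = 2 * M
    γ : ℕ → ℕ
    γ p with even-or-odd p
    ... | inj₁ (i , _) = i
    ... | inj₂ _       = M

    γ-even : ∀ i → γ (2 * i) ≡ i
    γ-even i with even-or-odd (2 * i)
    ... | inj₁ (i′ , eq) = sym (*-cancelˡ-≡ i i′ 2 eq)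
    ... | inj₂ (i′ , eq) = ⊥-elim (even≢odd i i′ eq)

    γ-odd : ∀ i → γ (suc (2 * i)) ≡ M
    γ-odd i with even-or-odd (suc (2 * i))
    ... | inj₁ (i′ , eq) = ⊥-elim (even≢odd i′ i (sym eq))
    ... | inj₂ _ = refl

    even< : ∀ {i} → 2 * i < n → i < M
    even< {i} = *-cancelˡ-< 2 i M

    range : ∀ {p} → p < n → γ p ≤ M
    range {p} p< with even-or-odd p
    ... | inj₁ (i , refl) = <⇒≤ (even< p<)
    ... | inj₂ _ = ≤-refl

    odd-link : ∀ i → suc (2 * i) < n → Star (PathLink c n γ) (suc (2 * i)) 1
    odd-link zero _ = ε
    odd-link (suc i) p< = (E-sym (subst (E c (suc (2 * i))) (sym up) (skip (subst (_< n) up p<))) ,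
        (p< , q<) , trans (γ-odd (suc i)) (sym (γ-odd i))) ◅ odd-link i q<
      where
      up : suc (2 * suc i) ≡ suc (suc (suc (2 * i)))
      up = cong suc (*-suc 2 i)
      q< : suc (2 * i) < n
      q< = <-trans (s≤s (≤-trans (n≤1+n _) (≤-reflexive (sym (*-suc 2 i))))) p<

    connected : ∀ {p q} → p < n → q < n → γ p ≡ γ q → Star (PathLink c n γ) p q
    connected {p} {q} p< q< eq with even-or-odd p | even-or-odd q
    ... | inj₁ (i , refl) | inj₁ (_ , refl) with refl ← eq = ε
    ... | inj₁ (i , refl) | inj₂ _ = ⊥-elim (<⇒≢ (even< p<) eq)
    ... | inj₂ _ | inj₁ (i , refl) = ⊥-elim (<⇒≢ (even< q<) (sym eq))
    ... | inj₂ (i , refl) | inj₂ (i′ , refl) =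
          odd-link i p< ◅◅ reverse PathLink-sym (odd-link i′ q<)

    rim : ∀ {i} → suc i < M → PathEdge c n γ i (suc i)
    rim {i} si< = 2 * i , 2 * suc i , <-trans (*-monoʳ-< 2 (n<1+n i)) q< , q< ,
        γ-even i , γ-even (suc i) ,
        subst (E c _) (sym (*-suc 2 i)) (skip (subst (_< n) (*-suc 2 i) q<))
      where
      q< : 2 * suc i < n
      q< = *-monoʳ-< 2 si<

    spoke : ∀ {i} → i < M → PathEdge c n γ M i
    spoke {i} i< = suc (2 * i) , 2 * i , p< , <-trans (n<1+n _) p< ,
        γ-odd i , γ-even i , E-sym (PathNet.path net p<)
      where
      p< : suc (2 * i) < n
      p< = ≤-trans (≤-reflexive (sym (*-suc 2 i))) (*-monoʳ-≤ 2 i<)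

  -- Cut points 0, 1, t₂, …, tᵢ = t, t′ with an edge from [tₛ, tₛ₊₁) to tₛ₊₂.
  data Chain (c : V → ℕ) : ℕ → ℕ → ℕ → Set where
    start : Chain c 0 0 1
    next  : ∀ {i t t′ x y} → Chain c i t t′ → t ≤ x → x < t′ → t′ < y → E c x y →
            Chain c (suc i) t′ y

  -- The number of the interval between cut points that contains the position. The last block,
  -- `suc i`, takes everything from `t′` on.
  block : ∀ {c i t t′} → Chain c i t t′ → ℕ → ℕ
  block start zero = 0
  block start (suc _) = 1
  block (next {i = i} {y = y} ch _ _ _ _) z with z <? y
  ... | yes _ = block ch z
  ... | no  _ = suc (suc i)

  module _ {c : V → ℕ} where
    block≤ : ∀ {i t t′} (ch : Chain c i t t′) z → block ch z ≤ suc i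
    block≤ start zero = z≤n
    block≤ start (suc _) = ≤-refl
    block≤ (next {y = y} ch _ _ _ _) z with z <? y
    ... | yes _ = m≤n⇒m≤1+n (block≤ ch z)
    ... | no  _ = ≤-refl

    block-mono : ∀ {i t t′} (ch : Chain c i t t′) {z w} → z ≤ w → block ch z ≤ block ch w
    block-mono start {zero} _ = z≤n
    block-mono start {suc z} {suc w} _ = ≤-refl
    block-mono (next {y = y} ch _ _ _ _) {z} {w} z≤w with z <? y | w <? y
    ... | yes _ | yes _ = block-mono ch z≤w
    ... | yes _ | no _ = m≤n⇒m≤1+n (block≤ ch z)
    ... | no z≮ | yes w< = ⊥-elim (z≮ (≤-<-trans z≤w w<))
    ... | no _ | no _ = ≤-refl

    block-hi : ∀ {i t t′} (ch : Chain c i t t′) {z} → t′ ≤ z → block ch z ≡ suc i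
    block-hi start {suc z} _ = refl
    block-hi (next {y = y} ch _ _ _ _) {z} y≤z with z <? y
    ... | yes z<y = ⊥-elim (<⇒≱ z<y y≤z)
    ... | no _ = refl

    block-lo : ∀ {i t t′ x y} (ch : Chain c i t t′) {p : t ≤ x} {q : x < t′} {r : t′ < y}
      {e : E c x y} {z} → z < y → block (next ch p q r e) z ≡ block ch z
    block-lo {y = y} ch {z = z} z<y with z <? y
    ... | yes _ = refl
    ... | no z≮ = ⊥-elim (z≮ z<y)

    block-mid : ∀ {i t t′} (ch : Chain c i t t′) {z} → t ≤ z → z < t′ → block ch z ≡ i
    block-mid start {zero} _ _ = refl
    block-mid start {suc z} _ (s≤s ())
    block-mid (next ch p q r e) t≤z z< = trans (block-lo ch {p} {q} {r} {e} z<) (block-hi ch t≤z)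

    cut-point : ∀ {i t t′} → Chain c i t t′ → ∃ λ s → suc s ≡ t′ × t ≤ s
    cut-point start = 0 , refl , z≤n
    cut-point (next {y = suc s} _ _ _ (s≤s t′≤s) _) = s , refl , t′≤s

    block-rim : ∀ {i t t′ p} (ch : Chain c i t t′) → p ≤ i →
      ∃ λ x → suc x ≤ t′ × block ch x ≡ p × block ch (suc x) ≡ suc p
    block-rim ch p≤i with m≤n⇒m<n∨m≡n p≤i
    ... | inj₂ refl with cut-point ch
    ...   | s , refl , t≤s = s , ≤-refl , block-mid ch t≤s ≤-refl , block-hi ch ≤-refl
    block-rim (next ch p q r e) _ | inj₁ (s≤s p≤) with block-rim ch p≤
    ... | x , x< , e₁ , e₂ = x , ≤-trans x< (<⇒≤ r) ,
          trans (block-lo ch {p} {q} {r} {e} (<-trans x< r)) e₁ ,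
          trans (block-lo ch {p} {q} {r} {e} (≤-<-trans x< r)) e₂

    block-skip : ∀ {i t t′ p} (ch : Chain c i t t′) → suc p ≤ i →
      ∃₂ λ x y → y ≤ t′ × block ch x ≡ p × block ch y ≡ suc (suc p) × E c x y
    block-skip (next {x = x} {y} ch p q r e) (s≤s p≤) with m≤n⇒m<n∨m≡n p≤
    ... | inj₂ refl = x , y , ≤-refl ,
          trans (block-lo ch {p} {q} {r} {e} (<-trans q r)) (block-mid ch p q) ,
          block-hi (next ch p q r e) ≤-refl , e
    ... | inj₁ p< with block-skip ch p<
    ...   | z , w , w≤ , e₁ , e₂ , e′ = z , w , ≤-trans w≤ (<⇒≤ r) ,
          trans (block-lo ch {p} {q} {r} {e} z<y) e₁ ,
          trans (block-lo ch {p} {q} {r} {e} (≤-<-trans w≤ r)) e₂ , e′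
      where
      z<y : z < y
      z<y = ≰⇒> λ y≤z → <⇒≱ (m≤n⇒m≤1+n p<)
        (≤-reflexive (trans (sym (block-hi ch (≤-trans (<⇒≤ r) y≤z))) e₁))

  -- Steps of the path across cut points link consecutive blocks; the edges of the chain link each
  -- block to the next but one.
  chain-square : ∀ {n c i t t′} → PathNet 0 n c → (ch : Chain c i t t′) → t′ < n →
    Square (2 + i) (block ch ∘ c)
  chain-square {n} {c} {i} {t} {t′} net ch t′<n = record
    { net = record
      { bags = relabel γ (bags net) (λ {p} _ → s≤s (block≤ ch p)) on
          (λ p< q< eq → Star.map (λ (e , _ , eq) → e , eq) (convex-connected net convex p< q< eq))
      ; path = λ { {p} (s≤s (s≤s p≤i)) → rim p≤i }
      ; apex = λ n≤p p<n → ⊥-elim (<⇒≱ p<n n≤p)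
      }
    ; skip = λ { {p} (s≤s (s≤s p<i)) → let x , y , y≤ , e₁ , e₂ , e = block-skip ch p<i in
                   subst₂ (E (γ ∘ c)) e₁ e₂ (E-map γ e) }
    }
    where
    γ = block ch

    convex : ∀ {x y z} → x ≤ z → z ≤ y → y < n → γ x ≡ γ y → γ z ≡ γ x
    convex x≤z z≤y _ eq =
      ≤-antisym (≤-trans (block-mono ch z≤y) (≤-reflexive (sym eq))) (block-mono ch x≤z)

    rim : ∀ {p} → p ≤ i → E (γ ∘ c) p (suc p)
    rim p≤i with block-rim ch p≤i
    ... | x , x< , e₁ , e₂ = subst₂ (E (γ ∘ c)) e₁ e₂ (E-map γ (path net (≤-<-trans x< t′<n)))

    on : ∀ {q} → q < 2 + i → ∃ λ p → p < n × γ p ≡ q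
    on {q} (s≤s q≤) with m≤n⇒m<n∨m≡n q≤
    ... | inj₂ refl = t′ , t′<n , block-hi ch ≤-refl
    ... | inj₁ (s≤s q≤i) = let x , x< , e₁ , _ = block-rim ch q≤i in
            x , <-trans x< t′<n , e₁

  -- Each t′ is the largest right end of an edge starting to the left of t, so
  -- the next edge starts in [t, t′).
  chain : ∀ {n c} W → PathNet 0 n c → Jumps c n →
    (∀ {a b} → E c a b → b < a + W) → ∀ i → suc (suc (i * W)) < n →
    ∃₂ λ t t′ → Chain c i t t′ × t′ ≤ suc (i * W) × (∀ {x y} → x < t → E c x y → y ≤ t′)
  chain W net jumps short zero _ = 0 , 1 , start , ≤-refl , λ ()
  chain {n} {c} W net jumps short (suc i) bound
    with chain W net jumps short i (≤-<-trans (s≤s (s≤s (m≤n+m (i * W) W))) bound)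
  ... | t , t′ , ch , t′≤ , max
    with cut-point ch | greatest (λ y → anyUpTo? (λ x → E? c x y) t′) n
  ...   | s , refl , _ | top
    -- Some edge jumps over `t′`, so the greatest right end reached from below `t′` lies beyond
    -- `t′`.
    with jumps z<s (≤-<-trans (s≤s (≤-trans t′≤ (s≤s (m≤n+m (i * W) W)))) bound)
  ...   | p , q , p<t′ , t′<q , e
    with top (q , proj₂ (E-bound (bags net) e) , p , p<t′ , e)
  ...   | y , y<n , (x , x<t′ , e′) , max′ =
          t′ , y , next ch t≤x x<t′ t′<y e′ , y≤ ,
          λ x< e → max′ (proj₂ (E-bound (bags net) e)) (_ , x< , e)
    where
    t′<y : t′ < y
    t′<y = <-≤-trans t′<q (max′ (proj₂ (E-bound (bags net) e)) (p , p<t′ , e))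
    t≤x : t ≤ x
    t≤x = ≮⇒≥ λ x<t → <⇒≱ t′<y (max x<t e′)
    y≤ : y ≤ suc (W + i * W)
    y≤ = ≤-trans (<⇒≤ (short e′)) (≤-trans (+-monoˡ-≤ W (<⇒≤ x<t′))
           (≤-trans (+-monoˡ-≤ W t′≤) (≤-reflexive (cong suc (+-comm (i * W) W)))))

  path-fan : ∀ κ m {c L} → 0 < κ → chainLength κ m < L → PathNet 0 (2 + L) c → Jumps c (2 + L) →
    ParallelMinor (Cₖ (suc κ)) G ⊎ (∃ λ c′ → PathNet 1 (suc m) c′)
  path-fan κ m {c} {L} κ>0 long net jumps = go (anyUpTo? (λ a →
      anyUpTo? (λ b → (a + W ≤? b) ×-dec E? c a b) n) n)
    where
    n = 2 + L
    W = (2 + κ) ^ (suc m + suc m)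

    go : Dec (∃ λ a → a < n × ∃ λ b → b < n × a + W ≤ b × E c a b) →
      ParallelMinor (Cₖ (suc κ)) G ⊎ (∃ λ c′ → PathNet 1 (suc m) c′)
    go (yes (a , a<n , b , b<n , aW≤b , e))
      -- The long edge spans `[a, a + W]` and therefore any stretch found inside it, which closes a
      -- cycle.
      with nest net κ m (suc m) (suc m) {l = a} {α = 0} {β = 0} refl refl refl
             (≤-<-trans aW≤b b<n) (none z≤n) (none (<⇒≤ (≤-<-trans aW≤b b<n)))
    ... | inj₁ fan = inj₂ fan
    ... | inj₂ stretch = inj₁ (stretch-cycle net ≤-refl aW≤b b<n e κ>0 stretch)
    go (no ¬far)
      with chain W net jumps
             (λ e → ≰⇒> λ far → ¬far (_ , proj₁ (E-bound (bags net) e) ,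
                                         _ , proj₂ (E-bound (bags net) e) , far , e))
             -- A chain of `2 * m` steps has `2 * suc m` blocks, of which the even ones make a path
             -- of `suc m`.
             (2 * m) (s≤s (s≤s long))
    ... | t , t′ , ch , t′≤ , _ =
          inj₂ (square-fan (subst (λ l → Square l (block ch ∘ c)) (sym (*-suc 2 m))
            (chain-square net ch (≤-trans (s≤s t′≤) (s≤s (m≤n⇒m≤1+n long))))))

-- Counting vertices.

count : ∀ {n} → (Fin n → Bool) → ℕ
count {zero}  P = 0
count {suc n} P = (if P zero then 1 else 0) + count (P ∘ suc)

count-true : ∀ n → count {n} (λ _ → true) ≡ n
count-true zero = refl
count-true (suc n) = cong suc (count-true n)

count-pos : ∀ {n} (P : Fin n → Bool) → 0 < count P → ∃ λ x → P x ≡ true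
count-pos {suc n} P pos with P zero in eq
... | true  = zero , eq
... | false = let x , Px = count-pos (P ∘ suc) pos in suc x , Px

count-∪ : ∀ {n} (P Q R : Fin n → Bool) →
  (∀ x → P x ≡ true → Q x ≡ true ⊎ R x ≡ true) → count P ≤ count Q + count R
count-∪ {zero} P Q R _ = z≤n
count-∪ {suc n} P Q R cover
  with P zero in p | Q zero in q | R zero in r |
       count-∪ (P ∘ suc) (Q ∘ suc) (R ∘ suc) (λ x → cover (suc x))
... | true  | true  | true  | ih = s≤s (≤-trans ih (+-monoʳ-≤ _ (n≤1+n _)))
... | true  | true  | false | ih = s≤s ih
... | true  | false | true  | ih = ≤-trans (s≤s ih) (≤-reflexive (sym (+-suc _ _)))
... | false | true  | true  | ih = m≤n⇒m≤1+n (≤-trans ih (+-monoʳ-≤ _ (n≤1+n _)))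
... | false | true  | false | ih = m≤n⇒m≤1+n ih
... | false | false | true  | ih = ≤-trans ih (+-monoʳ-≤ _ (n≤1+n _))
... | false | false | false | ih = ih
... | true  | false | false | ih with cover zero p
...   | inj₁ q′ with () ← trans (sym q) q′
...   | inj₂ r′ with () ← trans (sym r) r′

count-false : ∀ n → count {n} (λ _ → false) ≡ 0
count-false zero = refl
count-false (suc n) = count-false n

count-mono : ∀ {n} (P Q : Fin n → Bool) → (∀ x → P x ≡ true → Q x ≡ true) → count P ≤ count Q
count-mono {n} P Q sub = ≤-trans (count-∪ P Q (λ _ → false) (λ x → inj₁ ∘ sub x))
  (≤-reflexive (trans (cong (count Q +_) (count-false n)) (+-identityʳ _)))

count-remove : ∀ {n} (P : Fin n → Bool) v →
  count P ≤ suc (count (λ x → P x ∧ not (x == v)))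
count-remove {suc n} P zero with P zero
... | true  = s≤s (count-mono (P ∘ suc) _ λ _ Px → cong₂ _∧_ Px refl)
... | false = m≤n⇒m≤1+n (count-mono (P ∘ suc) _ λ _ Px → cong₂ _∧_ Px refl)
count-remove {suc n} P (suc v) with P zero
... | true  = s≤s (count-remove (P ∘ suc) v)
... | false = count-remove (P ∘ suc) v

count-strict : ∀ {n} (P Q : Fin n → Bool) b → (∀ x → P x ≡ true → Q x ≡ true) →
  P b ≡ false → Q b ≡ true → count P < count Q
count-strict P Q zero sub ¬Pb Qb rewrite ¬Pb | Qb =
  s≤s (count-mono (P ∘ suc) (Q ∘ suc) (λ x → sub (suc x)))
count-strict P Q (suc b) sub ¬Pb Qb
  with P zero in p | Q zero in q | count-strict (P ∘ suc) (Q ∘ suc) b (λ x → sub (suc x)) ¬Pb Qb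
... | true  | true  | ih = s≤s ih
... | true  | false | ih with () ← trans (sym (sub zero p)) q
... | false | true  | ih = m≤n⇒m≤1+n ih
... | false | false | ih = ih

==-true⁻ : ∀ {n} {a b : Fin n} → (a == b) ≡ true → a ≡ b
==-true⁻ e = toℕ-injective (≡ᵇ-true⁻ e)

==-refl : ∀ {n} (a : Fin n) → (a == a) ≡ true
==-refl a = ≡ᵇ-true⁺ {toℕ a} refl

-- Components of vertex sets.

module Components (G : Graph) (symm : ∀ x y → adj G x y ≡ adj G y x) where
  open Contractions G symm

  Inside : (V → Bool) → V → V → Set
  Inside D a b = Edge G a b × D a ≡ true × D b ≡ true

  Inside-sym : ∀ {D a b} → Inside D a b → Inside D b a
  Inside-sym (e , Da , Db) = Edge-sym e , Db , Da

  record Component (U D : V → Bool) : Set where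
    field
      sub       : ∀ {x} → D x ≡ true → U x ≡ true
      point     : V
      inhabited : D point ≡ true
      connected : ∀ {x} → D x ≡ true → Star (Inside D) point x
      closed    : ∀ {a b} → D a ≡ true → Edge G a b → U b ≡ true → D b ≡ true

  -- Add adjacent vertices of `U` to `D` one at a time until none is left; `fuel` bounds the number
  -- of vertices of `U` outside `D`.
  close-up : ∀ fuel {U D z} → count (λ y → U y ∧ not (D y)) < fuel →
    (∀ {x} → D x ≡ true → U x ≡ true) → D z ≡ true →
    (∀ {x} → D x ≡ true → Star (Inside D) z x) → ∃ (Component U)
  close-up (suc fuel) {U} {D} {z} lt sub Dz conn
    with any? (λ a → any? (λ b → (D a Bool.≟ true) ×-dec (adj G a b Bool.≟ true) ×-dec
                                 (U b Bool.≟ true) ×-dec (D b Bool.≟ false)))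
  ... | no maximal = D , record
        { sub = sub ; point = z ; inhabited = Dz ; connected = conn ; closed = closed }
    where
    closed : ∀ {a b} → D a ≡ true → Edge G a b → U b ≡ true → D b ≡ true
    closed {a} {b} Da e Ub with D b in Db
    ... | true = refl
    ... | false = ⊥-elim (maximal (a , b , Da , e , Ub , Db))
  ... | yes (a , b , Da , e , Ub , Db) =
        close-up fuel {U} {D′} (<-≤-trans smaller (≤-pred lt)) sub′ (old Dz) conn′
    where
    D′ : V → Bool
    D′ x = D x ∨ (x == b)
    old : ∀ {x} → D x ≡ true → D′ x ≡ true
    old = ∨-true⁺ˡ
    D′b : D′ b ≡ true
    D′b = ∨-true⁺ʳ {D b} (==-refl b)
    sub′ : ∀ {x} → D′ x ≡ true → U x ≡ true
    sub′ {x} D′x with ∨-true⁻ {D x} D′x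
    ... | inj₁ Dx = sub Dx
    ... | inj₂ x≡b = subst (λ y → U y ≡ true) (sym (==-true⁻ x≡b)) Ub
    lift : ∀ {x} → D x ≡ true → Star (Inside D′) z x
    lift Dx = Star.map (λ (e , Dp , Dq) → e , old Dp , old Dq) (conn Dx)
    conn′ : ∀ {x} → D′ x ≡ true → Star (Inside D′) z x
    conn′ {x} D′x with ∨-true⁻ {D x} D′x
    ... | inj₁ Dx = lift Dx
    ... | inj₂ x≡b = subst (Star _ z) (sym (==-true⁻ x≡b)) (lift Da ◅◅ ((e , old Da , D′b) ◅ ε))
    smaller : count (λ y → U y ∧ not (D′ y)) < count (λ y → U y ∧ not (D y))
    smaller = count-strict (λ y → U y ∧ not (D′ y)) (λ y → U y ∧ not (D y)) b fewer (trans (cong (λ t → U b ∧ not t) D′b) (Bool.∧-zeroʳ (U b)))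
                                  (cong₂ _∧_ Ub (cong not Db))
      where
      fewer : ∀ y → U y ∧ not (D′ y) ≡ true → U y ∧ not (D y) ≡ true
      fewer y p with ∧-true⁻ {U y} p
      ... | Uy , nD′ with D y
      ...   | false = cong₂ _∧_ Uy refl
      ...   | true = ⊥-elim (Bool.not-¬ {true} refl (sym nD′))

  component : ∀ {U z} → U z ≡ true → ∃ (Component U)
  component {U} {z} Uz = close-up _ {U} {_== z} ≤-refl
    (λ e → subst (λ y → U y ≡ true) (sym (==-true⁻ e)) Uz) (==-refl z)
    (λ e → subst (Star _ z) (sym (==-true⁻ e)) ε)

  -- d x < i says that x lies in the component number d x; d x = k that x has
  -- not been assigned to a component yet.
  record Comps (X : V → Bool) (k i : ℕ) (d : V → ℕ) : Set where
    field
      assigned : ∀ x → d x < i ⊎ d x ≡ k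
      inX      : ∀ {x} → d x < i → X x ≡ true
      nonempty : ∀ {j} → j < i → ∃ λ x → d x ≡ j
      joined   : ∀ {x y} → d x < i → d x ≡ d y → Star (Within d) x y
      closed   : ∀ {x y} → d x < i → Edge G x y → X y ≡ true → d y ≡ d x

  -- With `r` components still to be found, at least `r * m` vertices are unassigned. A component
  -- with fewer than `m` vertices is recorded and leaves enough for the rest; a larger one ends the
  -- search.
  peel : ∀ {X k m} r {i d} → 0 < m → r + i ≡ k → Comps X k i d →
    r * m ≤ count (λ x → X x ∧ (d x ≡ᵇ k)) →
    ∃ (Comps X k k) ⊎ (∃ λ D → Component X D × m ≤ count D)
  peel zero _ refl comps _ = inj₁ (_ , comps)
  peel {X} {k} {m} (suc r) {i} {d} m>0 eq comps big
    with component {λ x → X x ∧ (d x ≡ᵇ k)}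
           (proj₂ (count-pos (λ x → X x ∧ (d x ≡ᵇ k)) (<-≤-trans m>0 (≤-trans (m≤m+n m _) big))))
  ... | D , D-comp with <-≤-connex (count D) m
  ...   | inj₂ m≤D = inj₂ (D , record
            { sub = λ {x} Dx → proj₁ (∧-true⁻ {X x} (sub Dx)) ; point = point ; inhabited = inhabited
            ; connected = connected ; closed = closedX } , m≤D)
    where
    open Component D-comp
    -- `D` is known to be closed only among unassigned vertices. An edge to an assigned vertex
    -- would, that component being closed in `X`, make `a` assigned too.
    closedX : ∀ {a b} → D a ≡ true → Edge G a b → X b ≡ true → D b ≡ true
    closedX {a} {b} Da e Xb with Comps.assigned comps b
    ... | inj₂ db≡k = closed Da e (cong₂ _∧_ Xb (≡ᵇ-true⁺ db≡k))
    ... | inj₁ db<i = ⊥-elim (<⇒≢ (subst (_< k) (sym da≡db) (<-trans db<i i<k)) da≡k)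
      where
      i<k : i < k
      i<k = subst (i <_) eq (m<n+m i z<s)
      da≡k : d a ≡ k
      da≡k = ≡ᵇ-true⁻ (proj₂ (∧-true⁻ {X a} (sub Da)))
      da≡db : d a ≡ d b
      da≡db = Comps.closed comps db<i (Edge-sym e) (proj₁ (∧-true⁻ {X a} (sub Da)))
  ...   | inj₁ D<m = peel r {suc i} {d′} m>0 (trans (+-suc r i) eq) comps′
            (+-cancelˡ-≤ m _ _ (≤-trans big (≤-trans (count-∪ (λ x → X x ∧ (d x ≡ᵇ k)) D (λ x → X x ∧ (d′ x ≡ᵇ k)) cover) (+-monoˡ-≤ _ (<⇒≤ D<m)))))
    where
    open Component D-comp renaming (connected to D-conn; closed to D-closed)
    open Comps comps
    i<k : i < k
    i<k = subst (i <_) eq (m<n+m i z<s)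

    d′ : V → ℕ
    d′ x = if D x then i else d x
    d′-in : ∀ {x} → D x ≡ true → d′ x ≡ i
    d′-in Dx rewrite Dx = refl
    d′-out : ∀ {x} → D x ≡ false → d′ x ≡ d x
    d′-out Dx rewrite Dx = refl

    D⇒k : ∀ {x} → D x ≡ true → d x ≡ k
    D⇒k {x} Dx = ≡ᵇ-true⁻ (proj₂ (∧-true⁻ {X x} (sub Dx)))
    D⇒X : ∀ {x} → D x ≡ true → X x ≡ true
    D⇒X {x} Dx = proj₁ (∧-true⁻ {X x} (sub Dx))
    old⇒¬D : ∀ {x} → d x < i → D x ≡ false
    old⇒¬D {x} dx< with D x in eq
    ... | true = ⊥-elim (<⇒≢ (<-trans dx< i<k) (D⇒k eq))
    ... | false = refl
    d′-old : ∀ {x} → d x < i → d′ x ≡ d x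
    d′-old dx< = d′-out (old⇒¬D dx<)

    cover : ∀ x → X x ∧ (d x ≡ᵇ k) ≡ true → D x ≡ true ⊎ X x ∧ (d′ x ≡ᵇ k) ≡ true
    cover x Ux with D x
    ... | true = inj₁ refl
    ... | false = inj₂ Ux

    data New (x : V) : Set where
      fresh : D x ≡ true → New x
      old   : d x < i → New x
    new : ∀ {x} → d′ x < suc i → New x
    new {x} d′< with D x in eq
    ... | true = fresh eq
    ... | false with assigned x
    ...   | inj₁ dx< = old dx<
    ...   | inj₂ dx≡k = ⊥-elim (<⇒≱ (subst (i <_) (sym dx≡k) i<k) (≤-pred d′<))

    keep : ∀ {x y} → d x < i → Star (Within d) x y → Star (Within d′) x y
    keep dx< ε = ε
    keep dx< ((e , eq) ◅ ps) = (e , trans (d′-old dx<) (trans eq (sym (d′-old dy<)))) ◅ keep dy< ps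
      where dy< = subst (_< i) eq dx<

    comps′ : Comps X k (suc i) d′
    comps′ = record
      { assigned = assigned′ ; inX = inX′ ; nonempty = nonempty′ ; joined = joined′ ; closed = closed′ }
      where
      assigned′ : ∀ x → d′ x < suc i ⊎ d′ x ≡ k
      assigned′ x with D x
      ... | true = inj₁ ≤-refl
      ... | false = [ inj₁ ∘ m≤n⇒m≤1+n , inj₂ ]′ (assigned x)
      inX′ : ∀ {x} → d′ x < suc i → X x ≡ true
      inX′ d′< with new d′<
      ... | fresh Dx = D⇒X Dx
      ... | old dx< = inX dx<
      nonempty′ : ∀ {j} → j < suc i → ∃ λ x → d′ x ≡ j
      nonempty′ (s≤s j≤i) with m≤n⇒m<n∨m≡n j≤i
      ... | inj₂ refl = point , d′-in inhabited
      ... | inj₁ j<i with nonempty j<i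
      ...   | x , refl = x , d′-old j<i
      joined′ : ∀ {x y} → d′ x < suc i → d′ x ≡ d′ y → Star (Within d′) x y
      joined′ {x} {y} x< eq with new x< | new (subst (_< suc i) eq x<)
      ... | fresh Dx | fresh Dy = Star.map (λ (e , Da , Db) → e , trans (d′-in Da) (sym (d′-in Db)))
              (reverse Inside-sym (D-conn Dx) ◅◅ D-conn Dy)
      ... | fresh Dx | old dy< = ⊥-elim (<⇒≢ dy< (trans (sym (d′-old dy<)) (trans (sym eq) (d′-in Dx))))
      ... | old dx< | fresh Dy = ⊥-elim (<⇒≢ dx< (trans (sym (d′-old dx<)) (trans eq (d′-in Dy))))
      ... | old dx< | old dy< = keep dx< (joined dx< (trans (sym (d′-old dx<)) (trans eq (d′-old dy<))))
      closed′ : ∀ {x y} → d′ x < suc i → Edge G x y → X y ≡ true → d′ y ≡ d′ x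
      closed′ {x} {y} x< e Xy with new x<
      ... | old dx< = trans (d′-old (subst (_< i) (sym (closed dx< e Xy)) dx<))
                        (trans (closed dx< e Xy) (sym (d′-old dx<)))
      ... | fresh Dx with assigned y
      ...   | inj₂ dy≡k = trans (d′-in (D-closed Dx e (cong₂ _∧_ Xy (≡ᵇ-true⁺ dy≡k)))) (sym (d′-in Dx))
      ...   | inj₁ dy< = ⊥-elim (<⇒≢ (<-trans dy< i<k)
                (trans (sym (closed dy< (Edge-sym e) (D⇒X Dx))) (D⇒k Dx)))

-- Splitting a 2-connected graph into a long path of bags.

-- Vertices needed in the last bag for `r` more splits: one for the tip, and `k` times the next
-- size, so that a bag without `k` components still has a large one.
spineSize : ℕ → ℕ → ℕ
spineSize k zero    = 1
spineSize k (suc r) = suc (k * spineSize k r)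

spineSize>0 : ∀ k r → 0 < spineSize k r
spineSize>0 k zero    = z<s
spineSize>0 k (suc r) = z<s

module Spines (G : Graph) (symm : ∀ x y → adj G x y ≡ adj G y x)
              (cut-free : ∀ v → ConnectedWithout G v) where
  open Contractions G symm
  open Targets G symm
  open Paths G symm using (PathNet)
  open Chains G symm
  open Components G symm

  -- A path of bags 0, …, s+1 whose last bag is still to be split: tip is a
  -- vertex of the last bag adjacent to bag s.
  record Spine (s : ℕ) (c : V → ℕ) : Set where
    field
      bags   : Bags (2 + s) c
      path   : ∀ {p} → p < suc s → E c p (suc p)
      jumps  : Jumps c (2 + s)
      tip    : V
      base   : V
      c-tip  : c tip ≡ suc s
      c-base : c base ≡ s
      joint  : Edge G base tip

  module Split {s c} (spine : Spine s c) where
    open Spine spine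

    X : V → Bool
    X x = (c x ≡ᵇ suc s) ∧ not (x == tip)

    X⇒c : ∀ {x} → X x ≡ true → c x ≡ suc s
    X⇒c {x} Xx = ≡ᵇ-true⁻ (proj₁ (∧-true⁻ {c x ≡ᵇ suc s} Xx))

    X⁺ : ∀ {x} → c x ≡ suc s → x ≢ tip → X x ≡ true
    X⁺ cx x≢tip = cong₂ _∧_ (≡ᵇ-true⁺ cx) (not-==⁺ x≢tip)

    X⇒≢tip : ∀ {x} → X x ≡ true → x ≢ tip
    X⇒≢tip {x} Xx = not-==⁻ (proj₂ (∧-true⁻ {c x ≡ᵇ suc s} Xx))

    -- Such a `Q` is a union of components of the last bag minus its tip.
    module Closed (Q : V → Bool) (Q⊆X : ∀ {x} → Q x ≡ true → X x ≡ true)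
                  (closed : ∀ {a b} → Q a ≡ true → Edge G a b → X b ≡ true → Q b ≡ true) where

      Q-tip : Q tip ≡ false
      Q-tip with Q tip in eq
      ... | true = ⊥-elim (X⇒≢tip (Q⊆X eq) refl)
      ... | false = refl

      Kept : V → Set
      Kept x = c x ≡ suc s × Q x ≡ false

      -- A walk in the bag that starts outside `Q` cannot enter `Q` before it meets the tip, because
      -- `Q` is closed.
      retreat : ∀ {x} → Kept x → Star (λ a b → Edge G a b × Kept a × Kept b) x tip
      retreat kept@(cx , _) = go kept (conn bags (trans cx (sym c-tip)))
        where
        go : ∀ {x} → Kept x → Star (Within c) x tip →
          Star (λ a b → Edge G a b × Kept a × Kept b) x tip
        go kept ε = ε
        go {x} kept@(cx , Qx) (_◅_ {j = y} (e , eq) ps) with x Fin.≟ tip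
        ... | yes refl = ε
        ... | no x≢tip = (e , kept , kept-y) ◅ go kept-y ps
          where
          kept-y : Kept y
          kept-y with Q y in Qy
          ... | false = trans (sym eq) cx , refl
          ... | true with () ← trans (sym Qx) (closed Qy (Edge-sym e) (X⁺ cx x≢tip))

      toTip : ∀ {z} → Q z ≡ true → ∃ λ a → Q a ≡ true × Edge G a tip
      toTip Qz with exit Q (conn bags (trans (X⇒c (Q⊆X Qz)) (sym c-tip))) Qz Q-tip
      ... | a , b , (e , eq) , Qa , Qb with b Fin.≟ tip
      ...   | yes refl = a , Qa , e
      ...   | no b≢tip with () ← trans (sym Qb)
                             (closed Qa e (X⁺ (trans (sym eq) (X⇒c (Q⊆X Qa))) b≢tip))

      -- By 2-connectivity a walk avoiding the tip leads from `Q` to bag 0. Where it leaves `Q` it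
      -- must leave the whole bag, as `Q` is closed in `X`.
      toOut : ∀ {z} → Q z ≡ true → ∃₂ λ a b → Q a ≡ true × c b < suc s × Edge G a b
      toOut {z} Qz with onto bags z<s
      ... | o , co with exit Q (fromReach (cut-free tip z o (X⇒≢tip (Q⊆X Qz)) o≢tip)) Qz Q-o
        where
        o≢tip : o ≢ tip
        o≢tip refl with () ← trans (sym co) c-tip
        Q-o : Q o ≡ false
        Q-o with Q o in eq
        ... | false = refl
        ... | true with () ← trans (sym co) (X⇒c (Q⊆X eq))
      ... | a , b , (e , _ , b≢tip) , Qa , Qb = a , b , Qa , ≤∧≢⇒< (≤-pred (bound bags b)) c≢ , e
        where
        c≢ : c b ≢ suc s
        c≢ cb with () ← trans (sym Qb) (closed Qa e (X⁺ cb b≢tip))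

    -- A walk within an earlier bag never meets the last one, so `f` has to respect only the earlier
    -- bags.
    keep : ∀ {f : V → ℕ} → (∀ {x y} → c x ≢ suc s → c x ≡ c y → f x ≡ f y) →
      ∀ {x y} → c x ≢ suc s → Star (Within c) x y → Star (Within f) x y
    keep same c≢ ε = ε
    keep same c≢ ((e , eq) ◅ ps) = (e , same c≢ eq) ◅ keep same (c≢ ∘ trans eq) ps

    -- `D` becomes the new last bag and the rest of the old one stays connected through its tip. The
    -- old tip is the new base, and a neighbour of it in `D` the new tip.
    extend : ∀ {D} → Component X D →
      ∃ λ c′ → Spine (suc s) c′ × (∀ {x} → D x ≡ true → c′ x ≡ 2 + s)
    extend {D} D-comp = c′ , record
        { bags = record { bound = bound′ ; onto = onto′ ; conn = conn′ }
        ; path = path′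
        ; jumps = jumps′
        ; tip = proj₁ new-tip
        ; base = tip
        ; c-tip = c′-in (proj₁ (proj₂ new-tip))
        ; c-base = c′tip
        ; joint = Edge-sym (proj₂ (proj₂ new-tip))
        } , c′-in
      where
      open Component D-comp
      open Closed D sub closed

      c′ : V → ℕ
      c′ x = if D x then 2 + s else c x
      c′-in : ∀ {x} → D x ≡ true → c′ x ≡ 2 + s
      c′-in Dx rewrite Dx = refl
      c′-out : ∀ {x} → D x ≡ false → c′ x ≡ c x
      c′-out Dx rewrite Dx = refl
      c′-low : ∀ {x} → c x ≢ suc s → c′ x ≡ c x
      c′-low {x} c≢ with D x in eq
      ... | true = ⊥-elim (c≢ (X⇒c (sub eq)))
      ... | false = refl
      c≤c′ : ∀ x → c x ≤ c′ x
      c≤c′ x with D x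
      ... | true = <⇒≤ (bound bags x)
      ... | false = ≤-refl
      c′tip : c′ tip ≡ suc s
      c′tip = trans (c′-out Q-tip) c-tip

      new-tip : ∃ λ a → D a ≡ true × Edge G a tip
      new-tip = toTip inhabited

      bound′ : ∀ x → c′ x < 3 + s
      bound′ x with D x
      ... | true = ≤-refl
      ... | false = m≤n⇒m≤1+n (bound bags x)

      onto′ : ∀ {p} → p < 3 + s → ∃ λ x → c′ x ≡ p
      onto′ {p} p< with p ≟ 2 + s | p ≟ suc s
      ... | yes refl | _ = point , c′-in inhabited
      ... | no _ | yes refl = tip , c′tip
      ... | no ≢₂ | no ≢₁ with onto bags (≤∧≢⇒< (≤-pred p<) ≢₂)
      ...   | x , refl = x , c′-low ≢₁

      home : ∀ {x} → c x ≡ suc s → D x ≡ false → Star (Within c′) x tip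
      home cx Dx = Star.map
        (λ (e , (ca , Da) , (cb , Db)) →
          e , trans (c′-out Da) (trans ca (trans (sym cb) (sym (c′-out Db)))))
        (retreat (cx , Dx))

      conn′ : ∀ {x y} → c′ x ≡ c′ y → Star (Within c′) x y
      conn′ {x} {y} eq with D x in Dx | D y in Dy
      ... | true | true = Star.map (λ (e , Da , Db) → e , trans (c′-in Da) (sym (c′-in Db)))
              (reverse Inside-sym (connected Dx) ◅◅ connected Dy)
      ... | true | false = ⊥-elim (<⇒≢ (bound bags y) (sym eq))
      ... | false | true = ⊥-elim (<⇒≢ (bound bags x) eq)
      ... | false | false with c x ≟ suc s
      ...   | yes cx = home cx Dx ◅◅ reverse Within-sym (home (trans (sym eq) cx) Dy)
      ...   | no c≢ = keep (λ c≢ eq → trans (c′-low c≢)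
                (trans eq (sym (c′-low (c≢ ∘ trans eq))))) c≢ (conn bags eq)

      path′ : ∀ {p} → p < 2 + s → E c′ p (suc p)
      path′ {p} p< with p ≟ suc s | p ≟ s
      ... | yes refl | _ = tip , proj₁ new-tip , c′tip , c′-in (proj₁ (proj₂ new-tip)) ,
              Edge-sym (proj₂ (proj₂ new-tip))
      -- The edge given by `path` might end in `D`; `joint` ends at the old tip, which keeps its
      -- label.
      ... | no _ | yes refl = base , tip ,
              trans (c′-low (λ e → 1+n≢n (trans (sym e) c-base))) c-base , c′tip , joint
      ... | no ≢₁ | no ≢₀ with path (≤∧≢⇒< (≤-pred p<) ≢₁)
      ...   | x , y , refl , cy , e = x , y , c′-low ≢₁ ,
              trans (c′-low (λ eq → ≢₀ (suc-injective (trans (sym cy) eq)))) cy , e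

      jumps′ : Jumps c′ (3 + s)
      jumps′ {i} i>0 i< with i ≟ suc s
      -- The label `suc s` has just become inner; the edge from `D` to an earlier bag jumps over it.
      ... | yes refl with toOut inhabited
      ...   | a , b , Da , cb< , e = c b , 2 + s , cb< , n<1+n _ ,
              b , a , c′-low (<⇒≢ cb<) , c′-in Da , Edge-sym e
      -- Old jumps survive: the left end lies in an earlier bag and keeps its label, and the label
      -- of the right end can only grow.
      jumps′ {i} i>0 i< | no ≢₁ with jumps i>0 (s≤s (≤∧≢⇒< (≤-pred (≤-pred i<)) ≢₁))
      ... | _ , _ , p<i , i<q , x , y , refl , refl , e = c x , c′ y , p<i , <-≤-trans i<q (c≤c′ y) ,
              x , y , c′-low (<⇒≢ (<-trans p<i (≤∧≢⇒< (≤-pred (≤-pred i<)) ≢₁))) , refl , e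

    -- Bag 0 is all that lies outside the last bag, bag 1 the tip with the vertices in none of the
    -- `k` components, and the components are the other bags; being closed, they are pairwise
    -- non-adjacent.
    book : ∀ {k d} → Comps X k k d → ParallelMinor (K2k′ k) G
    book {k} {d} comps = K2k′-minor {c = f}
        (record { bound = bound′ ; onto = onto′ ; conn = conn′ })
        (base , tip , f-out (λ e → 1+n≢n (trans (sym e) c-base)) , f-tip , joint)
        (λ i<k → let x , dx = nonempty i<k
                     a , b , Qa , cb , e = Closed.toOut (Q _) (Q⊆X i<k) (Q-closed i<k) (≡ᵇ-true⁺ dx)
                 in b , a , f-out (<⇒≢ cb) , f-Q i<k Qa , Edge-sym e)
        (λ i<k → let x , dx = nonempty i<k
                     a , Qa , e = Closed.toTip (Q _) (Q⊆X i<k) (Q-closed i<k) (≡ᵇ-true⁺ dx)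
                 in tip , a , f-tip , f-Q i<k Qa , Edge-sym e)
        independent
      where
      open Comps comps

      f : V → ℕ
      f x with c x ≟ suc s | d x <? k
      ... | no _  | _     = 0
      ... | yes _ | no _  = 1
      ... | yes _ | yes _ = 2 + d x

      f-out : ∀ {x} → c x ≢ suc s → f x ≡ 0
      f-out {x} c≢ with c x ≟ suc s | d x <? k
      ... | no _ | _ = refl
      ... | yes cx | _ = ⊥-elim (c≢ cx)

      f-mid : ∀ {x} → c x ≡ suc s → ¬ d x < k → f x ≡ 1
      f-mid {x} cx d≮ with c x ≟ suc s | d x <? k
      ... | no c≢ | _ = ⊥-elim (c≢ cx)
      ... | yes _ | no _ = refl
      ... | yes _ | yes d< = ⊥-elim (d≮ d<)

      f-in : ∀ {x} → d x < k → f x ≡ 2 + d x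
      f-in {x} d< with c x ≟ suc s | d x <? k
      ... | no c≢ | _ = ⊥-elim (c≢ (X⇒c (inX d<)))
      ... | yes _ | no d≮ = ⊥-elim (d≮ d<)
      ... | yes _ | yes _ = refl

      data Place (x : V) : Set where
        out : c x ≢ suc s → Place x
        mid : c x ≡ suc s → ¬ d x < k → Place x
        inn : d x < k → Place x

      place : ∀ x → Place x
      place x with c x ≟ suc s | d x <? k
      ... | no c≢  | _      = out c≢
      ... | yes cx | no d≮  = mid cx d≮
      ... | yes _  | yes d< = inn d<

      Q : ℕ → V → Bool
      Q i x = d x ≡ᵇ i
      Q⊆X : ∀ {i} → i < k → ∀ {x} → Q i x ≡ true → X x ≡ true
      Q⊆X {i} i<k {x} Qx = inX (subst (_< k) (sym (≡ᵇ-true⁻ {d x} Qx)) i<k)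
      Q-closed : ∀ {i} → i < k → ∀ {a b} → Q i a ≡ true → Edge G a b → X b ≡ true → Q i b ≡ true
      Q-closed {i} i<k {a} Qa e Xb with refl ← ≡ᵇ-true⁻ {d a} {i} Qa = ≡ᵇ-true⁺ (closed i<k e Xb)
      f-Q : ∀ {i x} → i < k → Q i x ≡ true → f x ≡ 2 + i
      f-Q {i} {x} i<k Qx with refl ← ≡ᵇ-true⁻ {d x} {i} Qx = f-in i<k

      -- Taken for the union of all `k` components, `retreat` shows that bag 1 is connected.
      open Closed (λ x → d x <ᵇ k) (inX ∘ <ᵇ-true⁻)
        (λ da e Xb → <ᵇ-true⁺ (subst (_< k) (sym (closed (<ᵇ-true⁻ da) e Xb)) (<ᵇ-true⁻ da)))

      <ᵇ-false⁻ : ∀ {m n} → (m <ᵇ n) ≡ false → ¬ m < n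
      <ᵇ-false⁻ e m<n with () ← trans (sym e) (<ᵇ-true⁺ m<n)
      <ᵇ-false⁺ : ∀ {m n} → ¬ m < n → (m <ᵇ n) ≡ false
      <ᵇ-false⁺ {m} {n} ≮ with m <ᵇ n in eq
      ... | true = ⊥-elim (≮ (<ᵇ-true⁻ eq))
      ... | false = refl

      f-tip : f tip ≡ 1
      f-tip = f-mid c-tip (<ᵇ-false⁻ Q-tip)

      bound′ : ∀ x → f x < 2 + k
      bound′ x with place x
      ... | out c≢ = subst (_< 2 + k) (sym (f-out c≢)) z<s
      ... | mid cx d≮ = subst (_< 2 + k) (sym (f-mid cx d≮)) (s≤s z<s)
      ... | inn d< = subst (_< 2 + k) (sym (f-in d<)) (s≤s (s≤s d<))

      onto′ : ∀ {p} → p < 2 + k → ∃ λ x → f x ≡ p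
      onto′ {zero} _ = base , f-out (λ e → 1+n≢n (trans (sym e) c-base))
      onto′ {suc zero} _ = tip , f-tip
      onto′ {suc (suc i)} (s≤s (s≤s i<k)) with nonempty i<k
      ... | x , refl = x , f-in i<k

      keep-f : ∀ {x y} → c x ≢ suc s → c x ≡ c y → Star (Within f) x y
      keep-f c≢ eq = keep (λ c≢ eq → trans (f-out c≢) (sym (f-out (c≢ ∘ trans eq)))) c≢ (conn bags eq)

      -- Descend along the path of earlier bags; all of them lie in bag 0 of `f`.
      down : ∀ {o} → c o ≡ 0 → ∀ p → p < suc s → ∀ {x} → c x ≡ p → Star (Within f) x o
      down co zero p< cx = keep-f (λ e → 1+n≢0 (trans (sym e) cx)) (trans cx (sym co))
      down co (suc p) p< {x} cx with path (<-trans (n<1+n p) p<)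
      ... | x′ , y′ , cx′ , cy′ , e =
            keep-f (λ e → <⇒≢ p< (trans (sym cx) e)) (trans cx (sym cy′)) ◅◅
            ((Edge-sym e , trans (f-out (λ e → <⇒≢ p< (trans (sym cy′) e)))
                (sym (f-out (λ e → <⇒≢ (<-trans (n<1+n p) p<) (trans (sym cx′) e))))) ◅
             down co p (<-trans (n<1+n p) p<) cx′)

      toZero : ∀ {x} → c x ≢ suc s → Star (Within f) x (proj₁ (onto bags z<s))
      toZero {x} c≢ = down (proj₂ (onto bags z<s)) (c x) (≤∧≢⇒< (≤-pred (bound bags x)) c≢) refl

      home : ∀ {x} → c x ≡ suc s → ¬ d x < k → Star (Within f) x tip
      home cx d≮ = Star.map
        (λ (e , (ca , da) , (cb , db)) →
          e , trans (f-mid ca (<ᵇ-false⁻ da)) (sym (f-mid cb (<ᵇ-false⁻ db))))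
        (retreat (cx , <ᵇ-false⁺ d≮))

      lift : ∀ {x y} → d x < k → Star (Within d) x y → Star (Within f) x y
      lift d< ε = ε
      lift d< ((e , eq) ◅ ps) =
        (e , trans (f-in d<) (trans (cong (2 +_) eq) (sym (f-in (subst (_< k) eq d<))))) ◅
        lift (subst (_< k) eq d<) ps

      conn′ : ∀ {x y} → f x ≡ f y → Star (Within f) x y
      conn′ {x} {y} eq with place x | place y
      ... | out cx | out cy = toZero cx ◅◅ reverse Within-sym (toZero cy)
      ... | mid cx dx | mid cy dy = home cx dx ◅◅ reverse Within-sym (home cy dy)
      ... | inn dx | inn dy = lift dx (joined dx (suc-injective (suc-injective
              (trans (sym (f-in dx)) (trans eq (f-in dy))))))
      ... | out cx | mid cy dy with () ← trans (sym (f-out cx)) (trans eq (f-mid cy dy))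
      ... | out cx | inn dy with () ← trans (sym (f-out cx)) (trans eq (f-in dy))
      ... | mid cx dx | out cy with () ← trans (sym (f-mid cx dx)) (trans eq (f-out cy))
      ... | mid cx dx | inn dy with () ← trans (sym (f-mid cx dx)) (trans eq (f-in dy))
      ... | inn dx | out cy with () ← trans (sym (f-in dx)) (trans eq (f-out cy))
      ... | inn dx | mid cy dy with () ← trans (sym (f-in dx)) (trans eq (f-mid cy dy))

      independent : ∀ {i j} → E f (2 + i) (2 + j) → i ≡ j
      independent (x , y , fx , fy , e) with place x | place y
      ... | out cx | _ with () ← trans (sym (f-out cx)) fx
      independent (x , y , fx , fy , e) | mid cx dx | _ with () ← trans (sym (f-mid cx dx)) fx
      independent (x , y , fx , fy , e) | inn _ | out cy with () ← trans (sym (f-out cy)) fy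
      independent (x , y , fx , fy , e) | inn _ | mid cy dy with () ← trans (sym (f-mid cy dy)) fy
      independent (x , y , fx , fy , e) | inn dx | inn dy =
        suc-injective (suc-injective (trans (sym fx) (trans (f-in dx)
          (trans (cong (2 +_) (sym (closed dx e (inX dy)))) (trans (sym (f-in dy)) fy)))))

    split : ∀ k {m} → 0 < m → suc (k * m) ≤ count (λ x → c x ≡ᵇ suc s) →
      ParallelMinor (K2k′ k) G ⊎
      (∃ λ c′ → Spine (suc s) c′ × m ≤ count (λ x → c′ x ≡ᵇ 2 + s))
    split k {m} m>0 big with peel {X} {k} k {0} {λ _ → k} m>0 (+-identityʳ k) record
        { assigned = λ _ → inj₂ refl ; inX = λ () ; nonempty = λ () ; joined = λ () ; closed = λ () }
        (≤-trans (≤-pred (≤-trans big (count-remove (λ x → c x ≡ᵇ suc s) tip)))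
          (count-mono X _ λ _ Xx → cong₂ _∧_ Xx (≡ᵇ-true⁺ {k} refl)))
    ... | inj₁ (d , comps) = inj₁ (book comps)
    ... | inj₂ (D , D-comp , m≤D) with extend D-comp
    ...   | c′ , spine′ , in-D = inj₂ (c′ , spine′ ,
            ≤-trans m≤D (count-mono D _ λ _ Dx → ≡ᵇ-true⁺ (in-D Dx)))

  lengthen : ∀ k r {s t c} → r + s ≡ t → Spine s c →
    spineSize k r ≤ count (λ x → c x ≡ᵇ suc s) → ParallelMinor (K2k′ k) G ⊎ ∃ (Spine t)
  lengthen k zero refl spine _ = inj₂ (_ , spine)
  lengthen k (suc r) {s} eq spine big with Split.split spine k (spineSize>0 k r) big
  ... | inj₁ minor = inj₁ minor
  ... | inj₂ (c′ , spine′ , big′) = lengthen k r (trans (+-suc r s) eq) spine′ big′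

  initial : ∀ (v : V) {w} → w ≢ v → Connected G →
    ∃ λ c → Spine 0 c × (∀ {x} → not (x == v) ≡ true → c x ≡ 1)
  initial v {w} w≢v connected = c , record
      { bags = record { bound = bound′ ; onto = onto′ ; conn = conn′ }
      ; path = λ { {zero} _ → v , tip , c-v , c-other tip≢v , joint ; {suc _} (s≤s ()) }
      ; jumps = λ { {suc _} _ (s≤s (s≤s ())) }
      ; tip = tip ; base = v ; c-tip = c-other tip≢v ; c-base = c-v ; joint = joint
      } , (λ {x} e → c-other (not-==⁻ {a = x} {v} e))
    where
    c : V → ℕ
    c x = if x == v then 0 else 1
    c-v : c v ≡ 0
    c-v rewrite ==-refl v = refl
    c-other : ∀ {x} → x ≢ v → c x ≡ 1
    c-other x≢v rewrite ≡ᵇ-false⁺ (x≢v ∘ toℕ-injective) = refl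

    neighbour : ∃₂ λ a b → Edge G a b × (a == v) ≡ true × (b == v) ≡ false
    neighbour = exit (_== v) (fromReach (connected v w)) (==-refl v)
                  (≡ᵇ-false⁺ (w≢v ∘ toℕ-injective))
    tip : V
    tip = proj₁ (proj₂ neighbour)
    tip≢v : tip ≢ v
    tip≢v e = ≡ᵇ-false⁻ (proj₂ (proj₂ (proj₂ (proj₂ neighbour)))) (cong toℕ e)
    joint : Edge G v tip
    joint with neighbour
    ... | a , b , e , a≡v , _ = subst (λ z → Edge G z b) (==-true⁻ {a = a} {v} a≡v) e

    bound′ : ∀ x → c x < 2
    bound′ x with x == v
    ... | true = z<s
    ... | false = ≤-refl
    onto′ : ∀ {p} → p < 2 → ∃ λ x → c x ≡ p
    onto′ {zero} _ = v , c-v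
    onto′ {suc zero} _ = w , c-other w≢v
    onto′ {suc (suc _)} (s≤s (s≤s ()))

    conn′ : ∀ {x y} → c x ≡ c y → Star (Within c) x y
    conn′ {x} {y} eq with x Fin.≟ v | y Fin.≟ v
    ... | yes refl | yes refl = ε
    ... | yes refl | no y≢v with () ← trans (sym c-v) (trans eq (c-other y≢v))
    ... | no x≢v | yes refl with () ← trans (sym c-v) (trans (sym eq) (c-other x≢v))
    ... | no x≢v | no y≢v = Star.map (λ (e , a≢ , b≢) → e , trans (c-other a≢) (sym (c-other b≢)))
            (fromReach (cut-free v x y x≢v y≢v))

  spine : ∀ k t → Connected G → spineSize k t < order G → V → ParallelMinor (K2k′ k) G ⊎ ∃ (Spine t)
  spine k t connected big v =
    let w , w≢v = count-pos (λ x → not (x == v)) (<-≤-trans (spineSize>0 k t) others)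
        c , spine₀ , c-other = initial v (not-==⁻ {a = w} {v} w≢v) connected
    in lengthen k t (+-identityʳ t) spine₀
         (≤-trans others (count-mono (λ x → not (x == v)) _ λ x e → ≡ᵇ-true⁺ (c-other {x} e)))
    where
    others : spineSize k t ≤ count (λ x → not (x == v))
    others = ≤-pred (≤-trans big (≤-trans (≤-reflexive (sym (count-true (order G))))
               (count-remove {order G} (λ _ → true) v)))

  spine-net : ∀ {s c} → Spine s c → PathNet 0 (2 + s) c
  spine-net sp = record
    { bags = bags ; path = λ { (s≤s p<) → path p< } ; apex = λ n≤p p<n → ⊥-elim (<⇒≱ p<n n≤p) }
    where open Spine sp

  large-minor : ∀ k m L → 0 < k → chainLength k m < L →
    Connected G → V → spineSize (suc k) L < order G →
    (∀ {c} → PathNet 1 (suc m) c → ParallelMinor (Fₖ (suc k)) G ⊎ ParallelMinor (Kₖ (suc k)) G) →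
    ParallelMinor (K2k′ (suc k)) G ⊎ ParallelMinor (Cₖ (suc k)) G ⊎
    ParallelMinor (Fₖ (suc k)) G ⊎ ParallelMinor (Kₖ (suc k)) G
  large-minor k m L k>0 long connected v big fan with spine (suc k) L connected big v
  ... | inj₁ book = inj₁ book
  ... | inj₂ (c , sp) with path-fan k m k>0 long (spine-net sp) (Spine.jumps sp)
  ...   | inj₁ cycle = inj₂ (inj₁ cycle)
  ...   | inj₂ (c′ , net) = inj₂ (inj₂ (fan net))

spineLength : ℕ → ℕ
spineLength k = suc (chainLength (2 + k) (fanLength (3 + k) (suc k)))

orderBound : ℕ → ℕ
orderBound (suc (suc (suc k))) =
  suc (spineSize (3 + k) (spineLength k))
orderBound _ = 0

theorem1p5 : Σ (ℕ → ℕ) λ f → ∀ (k : ℕ) → 2 < k →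
    (G : Graph) → Simple G → TwoConnected G → f k ≤ order G →
    ParallelMinor (K2k′ k) G ⊎ ParallelMinor (Cₖ k) G ⊎
    ParallelMinor (Fₖ k) G ⊎ ParallelMinor (Kₖ k) G
theorem1p5 = orderBound , minor
  where
  minor : ∀ (k : ℕ) → 2 < k →
    (G : Graph) → Simple G → TwoConnected G → orderBound k ≤ order G →
    ParallelMinor (K2k′ k) G ⊎ ParallelMinor (Cₖ k) G ⊎
    ParallelMinor (Fₖ k) G ⊎ ParallelMinor (Kₖ k) G
  minor 1 (s≤s ())
  minor 2 (s≤s (s≤s ()))
  minor (suc (suc (suc k))) _ G (symm , _) (2<n , connected , cut-free) big =
    Spines.large-minor G symm cut-free (2 + k) (fanLength (3 + k) (suc k)) (spineLength k) z<s ≤-refl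
      connected (fromℕ< (<-trans z<s 2<n)) big
      (λ net → Pieces.apexes G symm (3 + k) (suc k) net refl)
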